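{- Consider the game $\mathbf{0.33}$ and the set $\mathcal{R}$ consisting of the empty graph and all subdivided stars whose paths all have $1$ or $2$ vertices. Define subsets of $\mathcal R$: $\mathcal D_0^*$ = elements $S$ with $\mathcal{G}(S)=0$ having zero or exactly two paths with $2$ vertices, together with $S_2$; $\mathcal D_1^*=\{P_1,S_{2,1},S_{2,2,2}\}$; $\mathcal D_1^{\Box}$ = stars $S\ne P_1$ with $\mathcal{G}(S)=1$ having zero or exactly two paths with $2$ vertices; $\mathcal D_2^*=\{S_1,S_{2,2}\}$; $\mathcal D_2^{\Box}$ = stars with $\mathcal{G}(S)=2$ having exactly one or exactly three paths with $2$ vertices; $\mathcal D_3^{\Box}$ = stars with $\mathcal{G}(S)=3$ having exactly one or exactly three paths with $2$ vertices; and for $i\in\{0,1,2,3\}$, $\mathcal D_i$ = elements $S$ with $\mathcal{G}(S)=i$ not in any previous class. Then the equivalence classes of $\mathcal R$ under $\sim_2$ are exactly $\mathcal D_0,\mathcal D_0^*,\mathcal D_1,\mathcal D_1^*,\mathcal D_1^{\Box},\mathcal D_2,\mathcal D_2^*,\mathcal D_2^{\Box},\mathcal D_3,\mathcal D_3^{\Box}$, and for $S$ in the class of the row and $S'$ in the class of the column, $\mathcal{G}(S\overset{2}{ - }S')$ is given by the table below, where $\oplus$ means $\mathcal{G}(S)\oplus\mathcal{G}(S')$ and $\oplus_1$ means $\mathcal{G}(S)\oplus\mathcal{G}(S')\oplus 1$: \[\begin{array}{c|cccccccccc} &\mathcal D_0 & \mathcal D_0^* & \mathcal D_1 & \mathcal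 D_1^* & \mathcal D_1^{\Box} & \mathcal D_2 & \mathcal D_2^* & \mathcal D_2^{\Box} & \mathcal D_3 & \mathcal D_3^{\Box} \\ \hline \mathcal D_0 & \oplus & \oplus_1 & \oplus & 2 & \oplus_1 & \oplus & 0 & \oplus_1 & \oplus & \oplus_1 \\ \mathcal D_0^* & \oplus_1 & \oplus_1 & \oplus_1 & 2 & \oplus_1 & \oplus_1 & 0 & \oplus_1 & \oplus_1 & \oplus_1 \\ \mathcal D_1 & \oplus & \oplus_1 & \oplus & 3 & \oplus_1 & \oplus & 1 & \oplus_1 & \oplus & \oplus_1 \\ \mathcal D_1^* & 2 & 2 & 3 & 0 & 3 & 0 & 1 & 1 & 1 & 0 \\ \mathcal D_1^{\Box} & \oplus_1 & \oplus_1 & \oplus_1 & 3 & \oplus_1 & \oplus_1 & 1 & \oplus_1 & \oplus_1 & \oplus_1 \\ \mathcal D_2 & \oplus & \oplus_1 & \oplus & 0 & \oplus_1 & \oplus & 2 & \oplus_1 & \oplus & \oplus_1 \\ \mathcal D_2^* & 0 & 0 & 1 & 1 & 1 & 2 & 2 & 2 & 3 & 3 \\ \mathcal D_2^{\Box} & \oplus_1 & \oplus_1 & \oplus_1 & 1 & \oplus_1 & \oplus_1 & 2 & 0 & \oplus_1 & 1 \\ \mathcal D_3 & \oplus & \oplus_1 & \oplus & 1 & \oplus_1 & \oplus & 3 & \oplus_1 & \oplus & \oplus_1 \\ \mathcal D_3^{\Box} & \oplus_1 & \oplus_1 & \oplus_1 & 0 & \oplus_1 & \oplus_1 & 3 &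 1 & \oplus_1 & 0 \end{array}\]
   Context: The game $\mathbf{0.33}$ on a finite graph $G$: players alternate; a move chooses a set $X$ of one vertex or of two adjacent vertices of $G$, lying in a connected component $H$ of $G$, such that $H-X$ is empty or connected, and deletes $X$. A player unable to move loses (normal play). Grundy value: $\mathcal{G}(G)=\mathrm{mex}\{\mathcal{G}(G'): G' \text{ reachable in one move}\}$; $\oplus$ is bitwise XOR. Subdivided star $S_{\ell_1,\ldots,\ell_k}$ ($k\ge0$, $\ell_i\ge1$): a central vertex $c$ with $k$ vertex-disjoint paths of $\ell_1,\ldots,\ell_k$ vertices each having one endpoint adjacent to $c$ ($P_1$ if $k=0$; $S_1=P_2$, $S_2=P_3$). Bistar: for subdivided stars $S,S'$ with centers $c,c'$, $S\overset{2}{ - }S'$ is the disjoint union of $S$ and $S'$ plus a new vertex $v$ adjacent to both $c$ and $c'$; if $S'$ is empty, $S\overset{2}{ - }\emptyset$ is $S$ plus a new vertex adjacent to $c$ (symmetrically for $S$ empty), and $\emptyset\overset{2}{ - }\emptyset=P_1$. $G_1\equiv G_2$ iff $\mathcal{G}(G_1)=\mathcal{G}(G_2)$. $S\sim_2 S'$ iff $S\overset{2}{ - }\hat S\equiv S'\overset{2}{ - }\hat S$ for every subdivided star (or empty graph) $\hat S$. -}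

module Defs where

open import Data.Nat using (ℕ; zero; suc; _+_; _*_; _<_; _≤_; _%_; _/_)
open import Data.Fin using (Fin; toℕ)
open import Data.List using (List; []; _∷_; _++_; replicate)
open import Data.Nat.ListAction using (sum)
open import Data.List.Relation.Unary.All using (All; []; _∷_)
open import Data.List.Membership.Propositional using (_∈_)
open import Data.Maybe using (Maybe; just; nothing)
open import Data.Product using (Σ; _×_; _,_; ∃)
open import Data.Sum using (_⊎_)
open import Data.Unit using (⊤)
open import Relation.Nullary using (¬_)
open import Relation.Binary.PropositionalEquality using (_≡_; _≢_)
open import Function.Bundles using (_⇔_)

-- Finite (simple, undirected) graphs.
-- Vertices are Fin n; edges are given as a list of pairs of indices
-- (as natural numbers); u and v are adjacent iff (u,v) or (v,u) is listed.

record Graph : Set where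
  field
    n : ℕ
    E : List (ℕ × ℕ)

module _ (G : Graph) where
  open Graph G

  Adj : Fin n → Fin n → Set
  Adj u v = ((toℕ u , toℕ v) ∈ E) ⊎ ((toℕ v , toℕ u) ∈ E)

  -- A game position is the induced subgraph on a set A of remaining vertices.
  VSet : Set₁
  VSet = Fin n → Set

  data Reach (A : VSet) (u : Fin n) : Fin n → Set where
    here : A u → Reach A u u
    step : ∀ {w v} → Reach A u w → Adj w v → A v → Reach A u v

  data Choice : Set where
    single : Fin n → Choice
    pair   : Fin n → Fin n → Choice

  InX : Choice → Fin n → Set
  InX (single x) v = v ≡ x
  InX (pair x y) v = (v ≡ x) ⊎ (v ≡ y)

  anchor : Choice → Fin n
  anchor (single x) = x
  anchor (pair x y) = x

  ValidX : VSet → Choice → Set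
  ValidX A (single x) = A x
  ValidX A (pair x y) = A x × A y × (x ≢ y) × Adj x y

  remove : VSet → Choice → VSet
  remove A X v = A v × ¬ InX X v

  -- H is the connected component of (the graph induced on) A containing X;
  -- H - X must be empty or connected.
  CompOK : VSet → Choice → Set
  CompOK A X = ∀ u v → Reach A (anchor X) u → ¬ InX X u
                     → Reach A (anchor X) v → ¬ InX X v
                     → Reach (remove A X) u v

  Move : VSet → Set
  Move A = Σ Choice (λ X → ValidX A X × CompOK A X)

  after : (A : VSet) → Move A → VSet
  after A (X , _) = remove A X

  -- IsGrundyF k A g : "the Grundy value of position A is g", computed with
  -- fuel k.  Each move removes at least one vertex, so fuel k ≥ |A| makes
  -- this the genuine (mex-recursive) Grundy value.
  IsGrundyF : ℕ → VSet → ℕ → Set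
  IsGrundyF zero    A g = g ≡ 0
  IsGrundyF (suc k) A g =
    (∀ (m : Move A) → ¬ IsGrundyF k (after A m) g) ×
    (∀ h → h < g → Σ (Move A) (λ m → IsGrundyF k (after A m) h))

Grundy : Graph → ℕ → Set
Grundy G g = IsGrundyF G (Graph.n G) (λ _ → ⊤) g

_≡𝒢_ : Graph → Graph → Set
G₁ ≡𝒢 G₂ = ∃ λ g → Grundy G₁ g × Grundy G₂ g

record SubdividedStar : Set where
  field
    paths    : List ℕ
    positive : All (λ ℓ → 1 ≤ ℓ) paths

OptStar : Set
OptStar = Maybe SubdividedStar

starSize : SubdividedStar → ℕ
starSize S = suc (sum (SubdividedStar.paths S))

chain : ℕ → ℕ → List (ℕ × ℕ)
chain p zero    = []
chain p (suc m) = (p , suc p) ∷ chain (suc p) m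

pathEdges : ℕ → ℕ → ℕ → List (ℕ × ℕ)
pathEdges c p zero    = []
pathEdges c p (suc L) = (c , p) ∷ chain p L

-- edges of the star with centre at index o and paths at o+1, o+2, …
starEdgesFrom : ℕ → ℕ → List ℕ → List (ℕ × ℕ)
starEdgesFrom o p []       = []
starEdgesFrom o p (L ∷ ls) = pathEdges o p L ++ starEdgesFrom o (p + L) ls

starEdges : ℕ → SubdividedStar → List (ℕ × ℕ)
starEdges o S = starEdgesFrom o (suc o) (SubdividedStar.paths S)

optSize : OptStar → ℕ
optSize nothing  = 0
optSize (just S) = starSize S

graphOf : OptStar → Graph
graphOf nothing  = record { n = 0 ; E = [] }
graphOf (just S) = record { n = starSize S ; E = starEdges 0 S }

attach : ℕ → OptStar → List (ℕ × ℕ)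
attach o nothing  = []
attach o (just S) = (0 , o) ∷ starEdges o S

-- bistar  S -2- S' : new vertex 0 adjacent to the centres of S and S'
bistar : OptStar → OptStar → Graph
bistar S S' = record
  { n = suc (optSize S + optSize S')
  ; E = attach 1 S ++ attach (suc (optSize S)) S' }

_∼₂_ : OptStar → OptStar → Set
S ∼₂ S' = ∀ (Ŝ : OptStar) → bistar S Ŝ ≡𝒢 bistar S' Ŝ

-- The set ℛ: the empty graph and the subdivided stars all of whose paths
-- have 1 or 2 vertices; such a star is determined (up to isomorphism) by
-- the number a of 1-vertex paths and the number b of 2-vertex paths.

data ℛ : Set where
  empty : ℛ
  star  : (a b : ℕ) → ℛ

all12 : ∀ a b → All (λ ℓ → 1 ≤ ℓ) (replicate a 1 ++ replicate b 2)
all12 (suc a) b = Data.Nat.s≤s Data.Nat.z≤n ∷ all12 a b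
all12 zero (suc b) = Data.Nat.s≤s Data.Nat.z≤n ∷ all12 zero b
all12 zero zero = []

toStar : ℛ → OptStar
toStar empty      = nothing
toStar (star a b) = just (record { paths = replicate a 1 ++ replicate b 2
                                 ; positive = all12 a b })

twos : ℛ → ℕ
twos empty      = 0
twos (star a b) = b

𝒢ℛ : ℛ → ℕ → Set
𝒢ℛ S g = Grundy (graphOf (toStar S)) g

P₁ S₁ S₂ S₂₁ S₂₂ S₂₂₂ : ℛ
P₁    = star 0 0
S₁    = star 1 0
S₂    = star 0 1
S₂₁   = star 1 1
S₂₂   = star 0 2
S₂₂₂  = star 0 3

ZeroOrTwo OneOrThree : ℕ → Set
ZeroOrTwo k  = (k ≡ 0) ⊎ (k ≡ 2)
OneOrThree k = (k ≡ 1) ⊎ (k ≡ 3)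

IsStar : ℛ → Set
IsStar empty      = Data.Empty.⊥ where import Data.Empty
IsStar (star _ _) = ⊤

D₀* D₁* D₁□ D₂* D₂□ D₃□ : ℛ → Set
D₀* S = (𝒢ℛ S 0 × ZeroOrTwo (twos S)) ⊎ (S ≡ S₂)
D₁* S = (S ≡ P₁) ⊎ (S ≡ S₂₁) ⊎ (S ≡ S₂₂₂)
D₁□ S = IsStar S × (S ≢ P₁) × 𝒢ℛ S 1 × ZeroOrTwo (twos S)
D₂* S = (S ≡ S₁) ⊎ (S ≡ S₂₂)
D₂□ S = IsStar S × 𝒢ℛ S 2 × OneOrThree (twos S)
D₃□ S = IsStar S × 𝒢ℛ S 3 × OneOrThree (twos S)

Special : ℛ → Set
Special S = D₀* S ⊎ D₁* S ⊎ D₁□ S ⊎ D₂* S ⊎ D₂□ S ⊎ D₃□ S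

Dᵢ : ℕ → ℛ → Set
Dᵢ i S = 𝒢ℛ S i × ¬ Special S

data Cls : Set where
  D0 D0* D1 D1* D1□ D2 D2* D2□ D3 D3□ : Cls

InClass : Cls → ℛ → Set
InClass D0  = Dᵢ 0
InClass D0* = D₀*
InClass D1  = Dᵢ 1
InClass D1* = D₁*
InClass D1□ = D₁□
InClass D2  = Dᵢ 2
InClass D2* = D₂*
InClass D2□ = D₂□
InClass D3  = Dᵢ 3
InClass D3□ = D₃□

-- bitwise XOR on ℕ (fuel ≥ m + n suffices)

xorF : ℕ → ℕ → ℕ → ℕ
xorF zero    m n = 0
xorF (suc k) m n = ((m % 2 + n % 2) % 2) + 2 * xorF k (m / 2) (n / 2)

_⊕_ : ℕ → ℕ → ℕ
m ⊕ n = xorF (suc (m + n)) m n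

data Entry : Set where
  x⊕ x⊕₁ : Entry
  c      : ℕ → Entry

table : Cls → Cls → Entry
table D0 D0 = x⊕
table D0 D0* = x⊕₁
table D0 D1 = x⊕
table D0 D1* = c 2
table D0 D1□ = x⊕₁
table D0 D2 = x⊕
table D0 D2* = c 0
table D0 D2□ = x⊕₁
table D0 D3 = x⊕
table D0 D3□ = x⊕₁
table D0* D0 = x⊕₁
table D0* D0* = x⊕₁
table D0* D1 = x⊕₁
table D0* D1* = c 2
table D0* D1□ = x⊕₁
table D0* D2 = x⊕₁
table D0* D2* = c 0
table D0* D2□ = x⊕₁
table D0* D3 = x⊕₁
table D0* D3□ = x⊕₁
table D1 D0 = x⊕
table D1 D0* = x⊕₁
table D1 D1 = x⊕
table D1 D1* = c 3
table D1 D1□ = x⊕₁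
table D1 D2 = x⊕
table D1 D2* = c 1
table D1 D2□ = x⊕₁
table D1 D3 = x⊕
table D1 D3□ = x⊕₁
table D1* D0 = c 2
table D1* D0* = c 2
table D1* D1 = c 3
table D1* D1* = c 0
table D1* D1□ = c 3
table D1* D2 = c 0
table D1* D2* = c 1
table D1* D2□ = c 1
table D1* D3 = c 1
table D1* D3□ = c 0
table D1□ D0 = x⊕₁
table D1□ D0* = x⊕₁
table D1□ D1 = x⊕₁
table D1□ D1* = c 3
table D1□ D1□ = x⊕₁
table D1□ D2 = x⊕₁
table D1□ D2* = c 1
table D1□ D2□ = x⊕₁
table D1□ D3 = x⊕₁
table D1□ D3□ = x⊕₁
table D2 D0 = x⊕
table D2 D0* = x⊕₁
table D2 D1 = x⊕
table D2 D1* = c 0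
table D2 D1□ = x⊕₁
table D2 D2 = x⊕
table D2 D2* = c 2
table D2 D2□ = x⊕₁
table D2 D3 = x⊕
table D2 D3□ = x⊕₁
table D2* D0 = c 0
table D2* D0* = c 0
table D2* D1 = c 1
table D2* D1* = c 1
table D2* D1□ = c 1
table D2* D2 = c 2
table D2* D2* = c 2
table D2* D2□ = c 2
table D2* D3 = c 3
table D2* D3□ = c 3
table D2□ D0 = x⊕₁
table D2□ D0* = x⊕₁
table D2□ D1 = x⊕₁
table D2□ D1* = c 1
table D2□ D1□ = x⊕₁
table D2□ D2 = x⊕₁
table D2□ D2* = c 2
table D2□ D2□ = c 0
table D2□ D3 = x⊕₁
table D2□ D3□ = c 1
table D3 D0 = x⊕
table D3 D0* = x⊕₁
table D3 D1 = x⊕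
table D3 D1* = c 1
table D3 D1□ = x⊕₁
table D3 D2 = x⊕
table D3 D2* = c 3
table D3 D2□ = x⊕₁
table D3 D3 = x⊕
table D3 D3□ = x⊕₁
table D3□ D0 = x⊕₁
table D3□ D0* = x⊕₁
table D3□ D1 = x⊕₁
table D3□ D1* = c 0
table D3□ D1□ = x⊕₁
table D3□ D2 = x⊕₁
table D3□ D2* = c 3
table D3□ D2□ = c 1
table D3□ D3 = x⊕₁
table D3□ D3□ = c 0

evalEntry : Entry → ℕ → ℕ → ℕ
evalEntry x⊕    g g' = g ⊕ g'
evalEntry x⊕₁   g g' = (g ⊕ g') ⊕ 1
evalEntry (c k) g g' = k

{-# OPTIONS --safe #-}
module Submission where

-- In a forest, deleting a vertex or an edge X keeps its component connected iff
-- at most one remaining vertex is adjacent to X; so the moves on a tree remove a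
-- leaf, or a leaf with its neighbour of degree 2.  On a star with at least three
-- arms, and on a bistar with at least two arms at each centre, these moves only
-- shorten an arm by 1 or 2.  Stars with at most two arms are paths, with value n
-- mod 3, and a bistar with at most one arm at a centre is a star with one arm
-- longer by 2.
--
-- A value depends only on the numbers a and b of arms of length 1 and 2 mod 3:
-- shortening an arm changes its residue, and any two residues of an arm give
-- different values, so the additional moves of a long arm never produce the
-- current value.  The class of (a , b) is eventually periodic with period 2 in
-- a and in b, hence the mex conditions reduce to finitely many cases.  The rows
-- of the table being distinct, the classes are those of ∼₂.

open import Defs
open import Data.Bool using (Bool; true; false; T)
open import Data.Empty using (⊥; ⊥-elim)
open import Data.Fin using (Fin; toℕ; zero; suc)
open import Data.Fin.Properties using (_≟_; all?; toℕ-fromℕ<; toℕ-injective; toℕ<n)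
open import Data.List using (List; []; _∷_; _++_; map; length; filter; replicate; downFrom)
open import Data.List.Membership.Propositional using (_∈_; _∉_)
open import Data.List.Membership.Propositional.Properties using (∈-++⁺ˡ; ∈-++⁺ʳ; ∈-++⁻; ∈-map⁺; ∈-map⁻; ∈-downFrom⁺)
open import Data.List.Properties using (map-++; map-cong; map-∘; map-id-local; length-map; ++-assoc; ++-identityʳ; ∷-injectiveˡ; ≡-dec)
open import Data.List.Relation.Binary.Permutation.Propositional using (_↭_; ↭-refl; ↭-sym; ↭-trans; ↭-prep; ↭-swap; ↭⇒↭ₛ)
open import Data.List.Relation.Binary.Permutation.Propositional.Properties using (∈-resp-↭; shift; shifts; ++⁺ʳ; ++⁺ˡ; ++-comm; ↭-length) renaming (map⁺ to ↭-map⁺; ++-assoc to ↭-assoc; ++-identityʳ to ↭-identityʳ)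
import Data.List.Relation.Binary.Permutation.Setoid.Properties as Permₛ
open import Data.List.Relation.Unary.All as All using (All; []; _∷_)
open import Data.List.Relation.Unary.All.Properties as All using ()
open import Data.List.Relation.Unary.AllPairs using ([]; _∷_)
open import Data.List.Relation.Unary.Any using (Any; here; there)
open import Data.List.Relation.Unary.Unique.Propositional using (Unique)
open import Data.List.Relation.Unary.Unique.Propositional.Properties using () renaming (map⁻ to unique-map⁻)
open import Data.Maybe using (just; nothing)
open import Data.Nat using (ℕ; zero; suc; _+_; _<_; _≤_; s≤s; z≤n; s≤s⁻¹; _≤ᵇ_) renaming (_≟_ to _≟ℕ_)
open import Data.List.Membership.DecPropositional _≟ℕ_ using (_∈?_)
open import Data.Nat.DivMod using (_mod_; m<n⇒m%n≡m; m%n<n)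
open import Data.Nat.ListAction using (sum)
open import Data.Nat.Properties using (<-cmp; <-irrefl; <-trans; <-≤-trans; <⇒≤; ≤-refl; ≤-reflexive; ≤-trans; ≤ᵇ⇒≤; n<1+n; m<m+n; m≤m+n; m≤n+m; m≤n⇒m≤1+n; m≤n⇒m<n∨m≡n; +-identityʳ; +-suc)
open import Data.Product using (Σ; _×_; _,_; ∃; ∃₂; proj₁; proj₂)
open import Data.Sum as Sum using (_⊎_; inj₁; inj₂; swap; [_,_]′)
open import Data.Unit using (⊤; tt)
open import Function.Bundles using (_⇔_; mk⇔)
open import Relation.Binary.Definitions using (tri<; tri≈; tri>)
open import Relation.Binary.PropositionalEquality using (_≡_; _≢_; refl; sym; trans; cong; cong₂; subst; subst₂; setoid)
open import Relation.Nullary using (¬_; Dec; yes; no)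
open import Relation.Nullary.Decidable using (¬?; _×-dec_; _⊎-dec_; from-yes; map′; True; toWitness)

-- Connectivity in forests

-- Although the classified stars have arms of length 1 and 2 only, `∼₂` tests them against all
-- subdivided stars, so bistars with arms of every length have to be evaluated. The two halves of a
-- mex condition then need different information. To exclude the current value, every legal move
-- must be known; it suffices that the residues 0, 1, 2 of one arm, over the same remaining arms,
-- give pairwise different values. To reach a smaller value, only moves that the counts guarantee
-- may be used: arms of residue 0 are invisible in `(a , b)`, so one is available only when there
-- are more arms than `a + b`. Positions are predicates on vertices, and a move produces a new
-- predicate. Values are therefore proved for a description by lists, simultaneously for all
-- predicates that fit it; the same graph may be described from several roots, and this turns paths,
-- stars and degenerate bistars into one another.

record IsForest (G : Graph) : Set where
  field
    up     : ∀ {x y} → (x , y) ∈ Graph.E G → x < y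
    parent : ∀ {x x' y} → (x , y) ∈ Graph.E G → (x' , y) ∈ Graph.E G → x ≡ x'

module _ {G : Graph} where
  open Graph G

  grundy-unique : ∀ k {A g h} → IsGrundyF G k A g → IsGrundyF G k A h → g ≡ h
  grundy-unique zero refl refl = refl
  grundy-unique (suc k) {g = g} {h} (ng , lg) (nh , lh) with <-cmp g h
  ... | tri≈ _ g≡h _ = g≡h
  ... | tri< g<h _ _ = let m , mg = lh g g<h in ⊥-elim (ng m mg)
  ... | tri> _ _ h<g = let m , mh = lg h h<g in ⊥-elim (nh m mh)

  adj-sym : ∀ {u v} → Adj G u v → Adj G v u
  adj-sym = swap

  reach-end : ∀ {B u v} → Reach G B u v → B v
  reach-end (here b)     = b
  reach-end (step _ _ b) = b

  reach-trans : ∀ {B u v w} → Reach G B u v → Reach G B v w → Reach G B u w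
  reach-trans r (here _)     = r
  reach-trans r (step s a b) = step (reach-trans r s) a b

  reach-sym : ∀ {B u v} → Reach G B u v → Reach G B v u
  reach-sym (here b)     = here b
  reach-sym (step {w} {v} r a b) =
    reach-trans (step (here b) (adj-sym {w} {v} a) (reach-end r)) (reach-sym r)

  reach-mono : ∀ {B C : VSet G} {u v} → (∀ {x} → B x → C x) → Reach G B u v → Reach G C u v
  reach-mono f (here b)     = here (f b)
  reach-mono f (step r a b) = step (reach-mono f r) a (f b)

  InX? : ∀ X v → Dec (InX G X v)
  InX? (single x) v = v ≟ x
  InX? (pair x y) v = (v ≟ x) ⊎-dec (v ≟ y)

  Boundary : VSet G → Choice G → Fin n → Set
  Boundary A X u = A u × ¬ InX G X u × ∃ λ x → InX G X x × Adj G x u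

  AtMostOne : (Fin n → Set) → Set
  AtMostOne P = ∀ {u w} → P u → P w → u ≡ w

  -- A walk entering X must leave it through the unique boundary vertex,
  -- so the excursion can be cut out.
  boundary⇒compOK : ∀ {A X} → AtMostOne (Boundary A X) → CompOK G A X
  boundary⇒compOK {A} {X} one u v ru u∉ rv v∉ with avoid (reach-trans (reach-sym ru) rv)
    where
    avoid : ∀ {z} → Reach G A u z →
            (¬ InX G X z × Reach G (remove G A X) u z) ⊎
            (InX G X z × ∃ λ q → Boundary A X q × Reach G (remove G A X) u q)
    avoid (here a) = inj₁ (u∉ , here (a , u∉))
    avoid (step {w} {z} r a b) with InX? X z | avoid r
    ... | yes z∈ | inj₁ (w∉ , s) = inj₂ (z∈ , w , (proj₁ (reach-end s) , w∉ , z , z∈ , adj-sym {w} {z} a) , s)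
    ... | no z∉  | inj₁ (w∉ , s) = inj₁ (z∉ , step s a (b , z∉))
    ... | yes z∈ | inj₂ (_ , q)  = inj₂ (z∈ , q)
    ... | no z∉  | inj₂ (w∈ , q , qb , s) =
      inj₁ (z∉ , subst (Reach G (remove G A X) u) (one qb (b , z∉ , w , w∈ , a)) s)
  ... | inj₁ (_ , s)  = s
  ... | inj₂ (v∈ , _) = ⊥-elim (v∉ v∈)

  module _ (forest : IsForest G) where
    open IsForest forest

    data Below (u : Fin n) : Fin n → Set where
      self  : Below u u
      child : ∀ {z w} → Below u z → (toℕ z , toℕ w) ∈ E → Below u w

    below-≤ : ∀ {u z} → Below u z → toℕ u ≤ toℕ z
    below-≤ self        = ≤-refl
    below-≤ (child d e) = ≤-trans (below-≤ d) (<⇒≤ (up e))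

    parent′ : ∀ {x y z : Fin n} → (toℕ x , toℕ z) ∈ E → (toℕ y , toℕ z) ∈ E → x ≡ y
    parent′ e e' = toℕ-injective (parent e e')

    -- The only edge out of the subtree of `u` leads to the parent of `u`, and that is the forbidden
    -- `x`.
    reach-below : ∀ {B x u z} → ¬ B x → (toℕ x , toℕ u) ∈ E → Reach G B u z → Below u z
    reach-below ¬x e (here b) = self
    reach-below ¬x e (step r (inj₁ d) b) = child (reach-below ¬x e r) d
    reach-below {B} ¬x e (step r (inj₂ d) b) with reach-below ¬x e r
    ... | self       = ⊥-elim (¬x (subst B (parent′ d e) b))
    ... | child s d' = subst (Below _) (parent′ d' d) s

    below-child : ∀ {x u w} → (toℕ x , toℕ u) ∈ E → Adj G x w → u ≢ w → ¬ Below u w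
    below-child e a u≢w self = u≢w refl
    below-child e (inj₁ d) u≢w (child s d') with refl ← parent′ d d' =
      <-irrefl refl (<-≤-trans (up e) (below-≤ s))
    below-child e (inj₂ d) u≢w s@(child _ _) =
      <-irrefl refl (<-≤-trans (<-trans (up d) (up e)) (below-≤ s))

    -- If one of the two is a child of `x`, walks from it stay below it. The other is not there: the
    -- parent of `x` has too small an index, and another child of `x` would bring `x` below its own
    -- child. Two parents of `x` coincide.
    acyclic : ∀ {B x u w} → ¬ B x → Adj G x u → Adj G x w → u ≢ w → ¬ Reach G B u w
    acyclic ¬x (inj₁ e) a u≢w r = below-child e a u≢w (reach-below ¬x e r)
    acyclic ¬x a (inj₁ e) u≢w r =
      below-child e a (λ eq → u≢w (sym eq)) (reach-below ¬x e (reach-sym r))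
    acyclic ¬x (inj₂ d) (inj₂ e) u≢w r = u≢w (parent′ d e)

    -- Two boundary vertices lie in the component of `X`, so `ok` joins them outside `X`, and `X`
    -- itself closes this walk to a cycle.
    compOK⇒boundary : ∀ {A X} → ValidX G A X → CompOK G A X → AtMostOne (Boundary A X)
    compOK⇒boundary {A} {single x} Ax ok {u} {w} (Au , u∉ , x , refl , xu) (Aw , w∉ , _ , refl , xw)
      with u ≟ w
    ... | yes eq = eq
    ... | no u≢w = ⊥-elim (acyclic (λ (_ , x∉) → x∉ refl) xu xw u≢w
                     (ok u w (step (here Ax) xu Au) u∉ (step (here Ax) xw Aw) w∉))
    compOK⇒boundary {A} {pair x y} (Ax , Ay , x≢y , xy) ok {u} {w} (Au , u∉ , z , z∈ , zu) (Aw , w∉ , z' , z'∈ , z'w)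
      with u ≟ w
    ... | yes eq = eq
    ... | no u≢w = ⊥-elim (absurd z∈ zu z'∈ z'w)
      where
      from : ∀ {z v} → InX G (pair x y) z → Adj G z v → A v → Reach G A x v
      from (inj₁ refl) a Av = step (here Ax) a Av
      from (inj₂ refl) a Av = step (step (here Ax) xy Ay) a Av

      r : Reach G (remove G A (pair x y)) u w
      r = ok u w (from z∈ zu Au) u∉ (from z'∈ z'w Aw) w∉

      absurd : ∀ {z z'} → InX G (pair x y) z → Adj G z u → InX G (pair x y) z' → Adj G z' w → ⊥
      absurd (inj₁ refl) zu (inj₁ refl) zw = acyclic (λ (_ , x∉) → x∉ (inj₁ refl)) zu zw u≢w r
      absurd (inj₂ refl) zu (inj₂ refl) zw = acyclic (λ (_ , y∉) → y∉ (inj₂ refl)) zu zw u≢w r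
      absurd (inj₁ refl) xu (inj₂ refl) yw =
        -- The walk from `u` to `w` is prolonged to `y`; now `u` and `y` are two neighbours of `x`
        -- joined by a walk that avoids `x` alone.
        acyclic {B = λ v → A v × v ≢ x} (λ (_ , x≢x) → x≢x refl) xu xy (λ u≡y → u∉ (inj₂ u≡y))
          (step (reach-mono (λ (Av , v∉) → Av , λ eq → v∉ (inj₁ eq)) r) (adj-sym {y} {w} yw)
                (Ay , λ eq → x≢y (sym eq)))
      absurd (inj₂ refl) yu (inj₁ refl) xw =
        acyclic {B = λ v → A v × v ≢ y} (λ (_ , y≢y) → y≢y refl) yu (adj-sym {x} {y} xy)
          (λ u≡x → u∉ (inj₁ u≡x))
          (step (reach-mono (λ (Av , v∉) → Av , λ eq → v∉ (inj₂ eq)) r) (adj-sym {x} {w} xw)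
                (Ax , x≢y))

-- Labelled trees and their moves

module _ {V : Set} where

  unique-↭ : {xs ys : List V} → xs ↭ ys → Unique xs → Unique ys
  unique-↭ p = Permₛ.Unique-resp-↭ (setoid V) (↭⇒↭ₛ p)

  unique-head : ∀ {x y} {xs : List V} → Unique (x ∷ xs) → y ∈ xs → x ≢ y
  unique-head (x≢ ∷ _) y∈ = All.lookup x≢ y∈

  unique-++⁻ : ∀ (xs : List V) {ys} → Unique (xs ++ ys) →
               Unique xs × Unique ys × (∀ {v} → v ∈ xs → v ∈ ys → ⊥)
  unique-++⁻ [] u = [] , u , λ ()
  unique-++⁻ (x ∷ xs) (x≢ ∷ u) with unique-++⁻ xs u
  ... | ux , uy , dis = (All.++⁻ˡ xs x≢ ∷ ux) , uy , dis'
    where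
    dis' : ∀ {v} → v ∈ x ∷ xs → v ∈ _ → ⊥
    dis' (here refl) v∈ = All.lookup x≢ (∈-++⁺ʳ xs v∈) refl
    dis' (there v∈xs) v∈ = dis v∈xs v∈

  data Tree : Set where
    node : V → List Tree → Tree

  -- Edges of the forest ts once its roots are hung on p, as (parent , child).
  edges : V → List Tree → List (V × V)
  edges p []               = []
  edges p (node x us ∷ ts) = (p , x) ∷ edges x us ++ edges p ts

  labels : List Tree → List V
  labels []               = []
  labels (node x us ∷ ts) = x ∷ labels us ++ labels ts

  labels≡targets : ∀ p ts → map proj₂ (edges p ts) ≡ labels ts
  labels≡targets p []               = refl
  labels≡targets p (node x us ∷ ts) =
    cong (x ∷_) (trans (map-++ proj₂ (edges x us) (edges p ts)) (cong₂ _++_ (labels≡targets x us) (labels≡targets p ts)))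

  target∈ : ∀ {p ts u v} → (u , v) ∈ edges p ts → v ∈ labels ts
  target∈ {p} {ts} e = subst (_ ∈_) (labels≡targets p ts) (∈-map⁺ proj₂ e)

  edge-into : ∀ {p ts v} → v ∈ labels ts → ∃ λ u → (u , v) ∈ edges p ts
  edge-into {p} {ts} v∈ with ∈-map⁻ proj₂ (subst (_ ∈_) (sym (labels≡targets p ts)) v∈)
  ... | (u , _) , e , refl = u , e

  source∈ : ∀ {p u v} ts → (u , v) ∈ edges p ts → u ∈ p ∷ labels ts
  source∈ (node x us ∷ ts) (here refl) = here refl
  source∈ (node x us ∷ ts) (there e) with ∈-++⁻ (edges x us) e
  ... | inj₁ e' = there (∈-++⁺ˡ {xs = x ∷ labels us} (source∈ us e'))
  ... | inj₂ e' with source∈ ts e'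
  ...   | here eq = here eq
  ...   | there q = there (there (∈-++⁺ʳ (labels us) q))

  Link : List (V × V) → V → V → Set
  Link es u v = (u , v) ∈ es ⊎ (v , u) ∈ es

  Outside : List (V × V) → List V → V → Set
  Outside es xs u = u ∉ xs × ∃ λ x → x ∈ xs × Link es x u

  -- The set to be deleted, with an edge always in its stored orientation, so that the two orders of
  -- a pair are one case.
  data Candidate (L : List V) (es : List (V × V)) : List V → Set where
    one : ∀ {x} → x ∈ L → Candidate L es (x ∷ [])
    two : ∀ {x y} → (x , y) ∈ es → Candidate L es (x ∷ y ∷ [])

  Narrow : List (V × V) → List V → Set
  Narrow es xs = ∀ {u w} → Outside es xs u → Outside es xs w → u ≡ w

  -- Deleting xs from the graph (L , es) leaves (L' , es'), and the deleted
  -- edges R meet the rest only in q.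
  record Cut (L : List V) (es : List (V × V)) (xs : List V) (L' : List V) (es' : List (V × V)) : Set where
    field
      R      : List (V × V)
      q      : V
      perm   : L ↭ xs ++ L'
      eperm  : es ↭ R ++ es'
      touch  : ∀ {u v} → (u , v) ∈ R → u ∈ xs ⊎ v ∈ xs
      funnel : ∀ {u v} → (u , v) ∈ R → (u ∉ xs → u ≡ q) × (v ∉ xs → v ≡ q)
      inside : ∀ {u v} → (u , v) ∈ es' → u ∈ L' × v ∈ L'

  cut⇒narrow : ∀ {L es xs L' es'} → Unique L → Cut L es xs L' es' → Narrow es xs
  cut⇒narrow {L} {es} {xs} {L'} {es'} uniq cut ou ow = trans (toq ou) (sym (toq ow))
    where
    open Cut cut
    disjoint : ∀ {v} → v ∈ xs → v ∈ L' → ⊥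
    disjoint = proj₂ (proj₂ (unique-++⁻ xs (unique-↭ perm uniq)))
    toq : ∀ {u} → Outside es xs u → u ≡ q
    toq (u∉ , x , x∈ , inj₁ e) with ∈-++⁻ R (∈-resp-↭ eperm e)
    ... | inj₁ r = proj₂ (funnel r) u∉
    ... | inj₂ r = ⊥-elim (disjoint x∈ (proj₁ (inside r)))
    toq (u∉ , x , x∈ , inj₂ e) with ∈-++⁻ R (∈-resp-↭ eperm e)
    ... | inj₁ r = proj₁ (funnel r) u∉
    ... | inj₂ r = ⊥-elim (disjoint x∈ (proj₂ (inside r)))

  -- The moves on a forest hung on p that leave p alone; the index is the list
  -- of deleted edges, whose targets are the deleted vertices.
  data Prune : V → List Tree → List (V × V) → List Tree → Set where
    leaf  : ∀ {p x ts} → Prune p (node x [] ∷ ts) ((p , x) ∷ []) ts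
    leaf₂ : ∀ {p x y ts} → Prune p (node x (node y [] ∷ []) ∷ ts) ((p , x) ∷ (x , y) ∷ []) ts
    down  : ∀ {p x us R us' ts} → Prune x us R us' → Prune p (node x us ∷ ts) R (node x us' ∷ ts)
    next  : ∀ {p t ts R ts'} → Prune p ts R ts' → Prune p (t ∷ ts) R (t ∷ ts')

  prune-edges : ∀ {p ts R ts'} → Prune p ts R ts' → edges p ts ↭ R ++ edges p ts'
  prune-edges leaf  = ↭-refl
  prune-edges leaf₂ = ↭-refl
  prune-edges (down {p} {x} {us} {R} {us'} {ts} π) =
    ↭-trans (↭-prep _ (↭-trans (++⁺ʳ (edges p ts) (prune-edges π)) (↭-assoc R (edges x us') (edges p ts))))
            (↭-sym (shift (p , x) R _))
  prune-edges (next {p} {node x us} {ts} {R} {ts'} π) =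
    ↭-trans (↭-prep _ (↭-trans (++⁺ˡ (edges x us) (prune-edges π)) (shifts (edges x us) R)))
            (↭-sym (shift (p , x) R _))

  prune-labels : ∀ {p ts R ts'} → Prune p ts R ts' → labels ts ↭ map proj₂ R ++ labels ts'
  prune-labels {p} {ts} {R} {ts'} π
    rewrite sym (labels≡targets p ts) | sym (labels≡targets p ts') | sym (map-++ proj₂ R (edges p ts'))
    = ↭-map⁺ proj₂ (prune-edges π)

  data Removed : List (V × V) → Set where
    one : ∀ {q x} → Removed ((q , x) ∷ [])
    two : ∀ {q x y} → Removed ((q , x) ∷ (x , y) ∷ [])

  removed : ∀ {p ts R ts'} → Prune p ts R ts' → Removed R
  removed leaf     = one
  removed leaf₂    = two
  removed (down π) = removed π
  removed (next π) = removed π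

  prune-cut : ∀ {p ts R ts'} → Prune p ts R ts' →
              Cut (p ∷ labels ts) (edges p ts) (map proj₂ R) (p ∷ labels ts') (edges p ts')
  prune-cut {p} {ts} {R} {ts'} π = record
    { R = R
    -- The removed piece hangs on the source of its first edge; any other source is itself removed.
    ; q = proj₁ (attached (removed π))
    ; perm = ↭-trans (↭-prep p (prune-labels π)) (↭-sym (shift p (map proj₂ R) _))
    ; eperm = prune-edges π
    ; touch = λ e → inj₂ (∈-map⁺ proj₂ e)
    ; funnel = λ e → proj₂ (attached (removed π)) e , λ v∉ → ⊥-elim (v∉ (∈-map⁺ proj₂ e))
    ; inside = λ e → source∈ ts' e , there (target∈ e)
    }
    where
    attached : ∀ {R} → Removed R → ∃ λ q → ∀ {u v} → (u , v) ∈ R → u ∉ map proj₂ R → u ≡ q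
    attached one = _ , λ { (here refl) _ → refl }
    attached two = _ , λ { (here refl) _ → refl ; (there (here refl)) u∉ → ⊥-elim (u∉ (here refl)) }

  prune-candidate : ∀ {p ts R ts'} → Prune p ts R ts' → Candidate (p ∷ labels ts) (edges p ts) (map proj₂ R)
  prune-candidate {p} {ts} {R} π = candidate (removed π) λ e → ∈-resp-↭ (↭-sym (prune-edges π)) (∈-++⁺ˡ e)
    where
    candidate : ∀ {R} → Removed R → (∀ {e} → e ∈ R → e ∈ edges p ts) →
                Candidate (p ∷ labels ts) (edges p ts) (map proj₂ R)
    candidate one into = one (there (target∈ (into (here refl))))
    candidate two into = two (into (there (here refl)))

  narrow-⊆ : ∀ {es es' xs} → (∀ {e} → e ∈ es' → e ∈ es) → Narrow es xs → Narrow es' xs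
  narrow-⊆ {es} {es'} {xs} sub nw ou ow = nw (widen ou) (widen ow)
    where
    widen : ∀ {u} → Outside es' xs u → Outside es xs u
    widen (u∉ , x , x∈ , inj₁ e) = u∉ , x , x∈ , inj₁ (sub e)
    widen (u∉ , x , x∈ , inj₂ e) = u∉ , x , x∈ , inj₂ (sub e)

  unique-down : ∀ {p x us ts} → Unique (p ∷ labels (node x us ∷ ts)) → Unique (x ∷ labels us)
  unique-down {x = x} {us} (_ ∷ u) = proj₁ (unique-++⁻ (x ∷ labels us) u)

  unique-next : ∀ {p x us ts} → Unique (p ∷ labels (node x us ∷ ts)) → Unique (p ∷ labels ts)
  unique-next {x = x} {us} (p≢ ∷ u) =
    All.++⁻ʳ (x ∷ labels us) p≢ ∷ proj₁ (proj₂ (unique-++⁻ (x ∷ labels us) u))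

  ∈₁⁻ : ∀ {u x : V} → u ∈ x ∷ [] → u ≡ x
  ∈₁⁻ (here eq) = eq

  ∈₂⁻ : ∀ {u x y : V} → u ∈ x ∷ y ∷ [] → u ≡ x ⊎ u ≡ y
  ∈₂⁻ (here eq)         = inj₁ eq
  ∈₂⁻ (there (here eq)) = inj₂ eq

  -- The parent of `x` is already one neighbour outside; a child would be a second, so `x` is a
  -- leaf.
  prune₁ : ∀ {p q x} ts → Unique (p ∷ labels ts) → (q , x) ∈ edges p ts → Narrow (edges p ts) (x ∷ []) →
           ∃₂ λ R ts' → Prune p ts R ts' × map proj₂ R ≡ x ∷ []
  prune₁ (node x [] ∷ ts) uniq (here refl) nw = _ , _ , leaf , refl
  prune₁ {p} (node x (node y vs ∷ us) ∷ ts) uniq (here refl) nw =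
    ⊥-elim (unique-head uniq (there (here refl)) (nw
      ((λ e → unique-head uniq (here refl) (∈₁⁻ e)) , x , here refl , inj₂ (here refl))
      ((λ e → unique-head (unique-down {us = node y vs ∷ us} {ts} uniq) (here refl) (sym (∈₁⁻ e))) ,
       x , here refl , inj₁ (there (here refl)))))
  prune₁ {p} (node z us ∷ ts) uniq (there e) nw with ∈-++⁻ (edges z us) e
  ... | inj₁ e' = let R , us' , π , eq = prune₁ us (unique-down uniq) e' (narrow-⊆ (λ d → there (∈-++⁺ˡ d)) nw)
                  in R , _ , down π , eq
  ... | inj₂ e' = let R , ts' , π , eq = prune₁ ts (unique-next uniq) e' (narrow-⊆ (λ d → there (∈-++⁺ʳ (edges z us) d)) nw)
                  in R , _ , next π , eq

  -- Since `p` is the one outside neighbour, `x` has no child besides `y`, and `y` has none.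
  prune₂-top : ∀ {p x y} us ts → Unique (p ∷ labels (node x us ∷ ts)) → (x , y) ∈ edges x us →
               Narrow (edges p (node x us ∷ ts)) (x ∷ y ∷ []) → us ≡ node y [] ∷ []
  prune₂-top {p} {x} {y} us ts uniq xy nw = shape us (unique-down uniq) no-child no-grandchild xy
    where
    p∉ : p ∉ x ∷ y ∷ []
    p∉ e with ∈₂⁻ e
    ... | inj₁ eq = unique-head uniq (here refl) eq
    ... | inj₂ eq = unique-head uniq (there (∈-++⁺ˡ (target∈ xy))) eq
    p-outside : Outside (edges p (node x us ∷ ts)) (x ∷ y ∷ []) p
    p-outside = p∉ , x , here refl , inj₂ (here refl)
    no-outside : ∀ {w z} → w ∈ labels us → w ≢ x → w ≢ y → z ∈ x ∷ y ∷ [] → (z , w) ∈ edges x us → ⊥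
    no-outside w∈ w≢x w≢y z∈ e = unique-head uniq (there (∈-++⁺ˡ w∈))
      (nw p-outside ((λ m → [ w≢x , w≢y ]′ (∈₂⁻ m)) , _ , z∈ , inj₁ (there (∈-++⁺ˡ e))))
    x≢ : ∀ {w} → w ∈ labels us → w ≢ x
    x≢ w∈ eq = unique-head (unique-down uniq) w∈ (sym eq)
    no-child : ∀ {w} → (x , w) ∈ edges x us → w ≢ y → ⊥
    no-child e w≢y = no-outside (target∈ e) (x≢ (target∈ e)) w≢y (here refl) e
    no-grandchild : ∀ {w} → (y , w) ∈ edges x us → w ≢ y → ⊥
    no-grandchild e w≢y = no-outside (target∈ e) (x≢ (target∈ e)) w≢y (there (here refl)) e
    shape : ∀ us → Unique (x ∷ labels us) → (∀ {w} → (x , w) ∈ edges x us → w ≢ y → ⊥) →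
            (∀ {w} → (y , w) ∈ edges x us → w ≢ y → ⊥) → (x , y) ∈ edges x us → us ≡ node y [] ∷ []
    shape (node _ [] ∷ []) u ch gc (here refl) = refl
    shape (node _ (node w ws ∷ vs) ∷ us) u ch gc (here refl) =
      ⊥-elim (gc (there (here refl)) λ eq → unique-head (unique-down {us = node w ws ∷ vs} {us} u) (here refl) (sym eq))
    shape (node _ [] ∷ node w ws ∷ us) u@(_ ∷ u') ch gc (here refl) =
      ⊥-elim (ch (there (here refl)) λ eq → unique-head u' (here refl) (sym eq))
    shape (node z vs ∷ us) u@(_ ∷ u') ch gc (there e) with ∈-++⁻ (edges z vs) e
    ... | inj₁ e' = ⊥-elim (unique-head u (∈-++⁺ˡ {xs = z ∷ labels vs} (source∈ vs e')) refl)
    ... | inj₂ e' = ⊥-elim (ch (here refl) λ eq → unique-head u' (∈-++⁺ʳ (labels vs) (target∈ e')) eq)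

  -- A pair containing the current root is handed back: one level up it becomes `leaf₂`, and at the
  -- top it is a move on the root.
  prune₂ : ∀ {p x y} ts → Unique (p ∷ labels ts) → (x , y) ∈ edges p ts → Narrow (edges p ts) (x ∷ y ∷ []) →
           x ≡ p ⊎ ∃₂ λ R ts' → Prune p ts R ts' × map proj₂ R ≡ x ∷ y ∷ []
  prune₂ (node z us ∷ ts) uniq (here refl) nw = inj₁ refl
  prune₂ (node z us ∷ ts) uniq (there e) nw with ∈-++⁻ (edges z us) e
  ... | inj₁ e' with prune₂ us (unique-down uniq) e' (narrow-⊆ (λ d → there (∈-++⁺ˡ d)) nw)
  ...   | inj₂ (R , us' , π , eq) = inj₂ (R , _ , down π , eq)
  ...   | inj₁ refl with refl ← prune₂-top us ts uniq e' nw = inj₂ (_ , _ , leaf₂ , refl)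
  prune₂ (node z us ∷ ts) uniq (there e) nw | inj₂ e'
    with prune₂ ts (unique-next uniq) e' (narrow-⊆ (λ d → there (∈-++⁺ʳ (edges z us) d)) nw)
  ... | inj₁ eq = inj₁ eq
  ... | inj₂ (R , ts' , π , eq) = inj₂ (R , _ , next π , eq)

  prune-classify : ∀ {r ts xs} → Unique (r ∷ labels ts) → Candidate (r ∷ labels ts) (edges r ts) xs →
                   Narrow (edges r ts) xs → r ∈ xs ⊎ ∃₂ λ R ts' → Prune r ts R ts' × map proj₂ R ≡ xs
  prune-classify uniq (one (here refl)) nw = inj₁ (here refl)
  prune-classify {ts = ts} uniq (one (there x∈)) nw = inj₂ (prune₁ ts uniq (proj₂ (edge-into x∈)) nw)
  prune-classify {ts = ts} uniq (two e) nw with prune₂ ts uniq e nw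
  ... | inj₁ refl = inj₁ (here refl)
  ... | inj₂ π    = inj₂ π

  companion : ∀ {L es xs r} → Candidate L es xs → r ∈ xs → ∃ λ y → y ∈ xs × (∀ {v} → v ∈ xs → v ≡ r ⊎ v ≡ y)
  -- A single root is its own companion, so that both kinds of move are the pair of `r` and `y`.
  companion {r = r} (one _) (here refl) = r , here refl , λ v∈ → inj₁ (∈₁⁻ v∈)
  companion (two {x} {y} _) (here refl) = y , there (here refl) , ∈₂⁻
  companion (two {x} {y} _) (there (here refl)) = x , here refl , λ v∈ → swap (∈₂⁻ v∈)

  -- A candidate containing the root misses two of its children, or one child and a grandchild.
  module RootBlocked (_≟_ : ∀ (u v : V) → Dec (u ≡ v)) where

    blocked₃ : ∀ {r t₁ t₂ t₃ ts xs} → let us = t₁ ∷ t₂ ∷ t₃ ∷ ts in Unique (r ∷ labels us) →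
               Candidate (r ∷ labels us) (edges r us) xs → Narrow (edges r us) xs → r ∉ xs
    blocked₃ {r} {node x₁ u₁} {node x₂ u₂} {node x₃ u₃} {ts} {xs} uniq@(_ ∷ uniq₁) cand nw r∈
      with companion cand r∈
    ... | y , y∈ , only = conclude (x₁ ≟ y) (x₂ ≟ y)
      where
      in₂ = ∈-++⁺ʳ (labels u₁) {x₂ ∷ labels u₂ ++ x₃ ∷ labels u₃ ++ labels ts} (here refl)
      in₃ = ∈-++⁺ʳ (labels u₁) {x₂ ∷ labels u₂ ++ x₃ ∷ labels u₃ ++ labels ts} (there (∈-++⁺ʳ (labels u₂) (here refl)))
      e₂ = ∈-++⁺ʳ (edges x₁ u₁) {edges r (node x₂ u₂ ∷ node x₃ u₃ ∷ ts)} (here refl)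
      e₃ = ∈-++⁺ʳ (edges x₁ u₁) {edges r (node x₂ u₂ ∷ node x₃ u₃ ∷ ts)} (there (∈-++⁺ʳ (edges x₂ u₂) (here refl)))
      x₂≢x₃ : x₂ ≢ x₃
      x₂≢x₃ = unique-head (proj₁ (proj₂ (unique-++⁻ (x₁ ∷ labels u₁) uniq₁))) (∈-++⁺ʳ (labels u₂) (here refl))
      out : ∀ {x} → x ∈ labels (node x₁ u₁ ∷ node x₂ u₂ ∷ node x₃ u₃ ∷ ts) →
            (r , x) ∈ edges r (node x₁ u₁ ∷ node x₂ u₂ ∷ node x₃ u₃ ∷ ts) → x ≢ y → Outside _ xs x
      out x∈ e x≢y = (λ m → [ (λ eq → unique-head uniq x∈ (sym eq)) , x≢y ]′ (only m)) , r , r∈ , inj₁ e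
      conclude : Dec (x₁ ≡ y) → Dec (x₂ ≡ y) → ⊥
      conclude (yes refl) _ = x₂≢x₃ (nw
        (out (there in₂) (there e₂) λ eq → unique-head uniq₁ in₂ (sym eq))
        (out (there in₃) (there e₃) λ eq → unique-head uniq₁ in₃ (sym eq)))
      conclude (no x₁≢y) (no x₂≢y) = unique-head uniq₁ in₂ (nw
        (out (here refl) (here refl) x₁≢y)
        (out (there in₂) (there e₂) x₂≢y))
      conclude (no x₁≢y) (yes refl) = unique-head uniq₁ in₃ (nw
        (out (here refl) (here refl) x₁≢y)
        (out (there in₃) (there e₃) λ eq → x₂≢x₃ (sym eq)))

    blocked₂ : ∀ {r x₁ s₁ u₁ x₂ s₂ u₂ ts xs} → let us = node x₁ (s₁ ∷ u₁) ∷ node x₂ (s₂ ∷ u₂) ∷ ts in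
               Unique (r ∷ labels us) → Candidate (r ∷ labels us) (edges r us) xs → Narrow (edges r us) xs → r ∉ xs
    blocked₂ {r} {x₁} {node z₁ v₁} {u₁} {x₂} {node z₂ v₂} {u₂} {ts} {xs} uniq@(_ ∷ uniq₁) cand nw r∈
      with companion cand r∈
    ... | y , y∈ , only = conclude (x₁ ≟ y) (x₂ ≟ y)
      where
      ts₁ = node z₁ v₁ ∷ u₁
      ts₂ = node z₂ v₂ ∷ u₂
      us = node x₁ ts₁ ∷ node x₂ ts₂ ∷ ts
      in₂ = ∈-++⁺ʳ (labels ts₁) {x₂ ∷ labels ts₂ ++ labels ts} (here refl)
      in₄ = ∈-++⁺ʳ (labels ts₁) {x₂ ∷ labels ts₂ ++ labels ts} (there (here refl))
      e₂ = ∈-++⁺ʳ (edges x₁ ts₁) {edges r (node x₂ ts₂ ∷ ts)} (here refl)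
      e₄ = ∈-++⁺ʳ (edges x₁ ts₁) {edges r (node x₂ ts₂ ∷ ts)} (there (here refl))
      dis : ∀ {v} → v ∈ x₁ ∷ labels ts₁ → v ∈ labels (node x₂ ts₂ ∷ ts) → ⊥
      dis = proj₂ (proj₂ (unique-++⁻ (x₁ ∷ labels ts₁) uniq₁))
      out : ∀ {x z} → z ∈ xs → x ∈ labels us → (z , x) ∈ edges r us → x ≢ y → Outside (edges r us) xs x
      out z∈ x∈ e x≢y = (λ m → [ (λ eq → unique-head uniq x∈ (sym eq)) , x≢y ]′ (only m)) , _ , z∈ , inj₁ e
      conclude : Dec (x₁ ≡ y) → Dec (x₂ ≡ y) → ⊥
      conclude (no x₁≢y) (no x₂≢y) = dis (here refl) (here (nw
        (out r∈ (here refl) (here refl) x₁≢y)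
        (out r∈ (there in₂) (there e₂) x₂≢y)))
      conclude (yes refl) _ = dis (there (here refl)) (here (nw
        (out y∈ (there (here refl)) (there (here refl)) λ eq → unique-head uniq₁ (here refl) (sym eq))
        (out r∈ (there in₂) (there e₂) λ eq → dis (here refl) (here (sym eq)))))
      conclude (no x₁≢y) (yes refl) = dis (here refl) (there (here (nw
        (out r∈ (here refl) (here refl) x₁≢y)
        (out y∈ (there in₄) (there e₄) λ eq →
          unique-head (proj₁ (proj₂ (unique-++⁻ (x₁ ∷ labels ts₁) uniq₁))) (here refl) (sym eq)))))

-- Arms and their shortenings

data Chain {V : Set} : Tree {V} → ℕ → Set where
  end  : ∀ {x} → Chain (node x []) 1
  link : ∀ {x t n} → Chain t n → Chain (node x (t ∷ [])) (suc n)

data Arms {V : Set} : List (Tree {V}) → List ℕ → Set where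
  []  : Arms [] []
  _∷_ : ∀ {t ts n ns} → Chain t n → Arms ts ns → Arms (t ∷ ts) (n ∷ ns)

data Shorten : List ℕ → List ℕ → Set where
  drop₁ : ∀ {ls} → Shorten (1 ∷ ls) ls
  drop₂ : ∀ {ls} → Shorten (2 ∷ ls) ls
  less₁ : ∀ {n ls} → Shorten (2 + n ∷ ls) (1 + n ∷ ls)
  less₂ : ∀ {n ls} → Shorten (3 + n ∷ ls) (1 + n ∷ ls)
  later : ∀ {n ls ls'} → Shorten ls ls' → Shorten (n ∷ ls) (n ∷ ls')

module _ {V : Set} where

  prune-arms : ∀ {p : V} {ts R ts' ls} → Prune p ts R ts' → Arms ts ls → ∃ λ ls' → Arms ts' ls' × Shorten ls ls'
  prune-arms leaf (end ∷ as) = _ , as , drop₁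
  prune-arms leaf₂ (link end ∷ as) = _ , as , drop₂
  prune-arms (next π) (a ∷ as) = let ls' , as' , s = prune-arms π as in _ , a ∷ as' , later s
  -- Seen from its first vertex, the rest of an arm is a forest with a single arm. Dropping that
  -- rest leaves the first vertex, so `drop` turns into `less`.
  prune-arms (down π) (link a ∷ as) with prune-arms π (a ∷ [])
  ... | _ , []        , drop₁ = _ , end ∷ as , less₁
  ... | _ , []        , drop₂ = _ , end ∷ as , less₂
  ... | _ , (a' ∷ []) , less₁ = _ , link a' ∷ as , less₁
  ... | _ , (a' ∷ []) , less₂ = _ , link a' ∷ as , less₂

  -- Polymorphic in the siblings `ts`: inside the chain there are none, at the centre there are the
  -- other arms.
  shorten₁ : ∀ p n {t} → Chain t (2 + n) → ∃₂ λ R t' → Chain t' (1 + n) × ∀ {ts} → Prune {V} p (t ∷ ts) R (t' ∷ ts)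
  shorten₁ p zero    (link end) = _ , _ , end , down leaf
  shorten₁ p (suc n) (link a) = let R , t' , a' , π = shorten₁ _ n a in R , _ , link a' , down π

  shorten₂ : ∀ p n {t} → Chain t (3 + n) → ∃₂ λ R t' → Chain t' (1 + n) × ∀ {ts} → Prune {V} p (t ∷ ts) R (t' ∷ ts)
  shorten₂ p zero    (link (link end)) = _ , _ , end , down leaf₂
  shorten₂ p (suc n) (link a) = let R , t' , a' , π = shorten₂ _ n a in R , _ , link a' , down π

  arms-prune : ∀ {p : V} {ts ls ls'} → Arms ts ls → Shorten ls ls' → ∃₂ λ R ts' → Prune p ts R ts' × Arms ts' ls'
  arms-prune (end ∷ as) drop₁ = _ , _ , leaf , as
  arms-prune (link end ∷ as) drop₂ = _ , _ , leaf₂ , as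
  arms-prune (a ∷ as) less₁ = let R , t' , a' , π = shorten₁ _ _ a in R , _ , π , a' ∷ as
  arms-prune (a ∷ as) less₂ = let R , t' , a' , π = shorten₂ _ _ a in R , _ , π , a' ∷ as
  arms-prune (a ∷ as) (later s) = let R , ts' , π , as' = arms-prune as s in R , _ , next π , a ∷ as'

-- Residues mod 3 and cuts at the end of a path

mod₃ : ℕ → ℕ
mod₃ 0 = 0
mod₃ 1 = 1
mod₃ 2 = 2
mod₃ (suc (suc (suc n))) = mod₃ n

mod₃-suc≢ : ∀ n → mod₃ (suc n) ≢ mod₃ n
mod₃-suc≢ 0 ()
mod₃-suc≢ 1 ()
mod₃-suc≢ 2 ()
mod₃-suc≢ (suc (suc (suc n))) = mod₃-suc≢ n

mod₃-2+≢ : ∀ n → mod₃ (2 + n) ≢ mod₃ n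
mod₃-2+≢ 0 ()
mod₃-2+≢ 1 ()
mod₃-2+≢ 2 ()
mod₃-2+≢ (suc (suc (suc n))) = mod₃-2+≢ n

-- The residue falls by one per vertex until it is 0, and it is at most 2, so removing one or two
-- vertices gives every smaller value.
below-mod₃ : ∀ n {h} → h < mod₃ (suc n) → h ≡ mod₃ n ⊎ ∃ λ m → n ≡ suc m × h ≡ mod₃ m
below-mod₃ 0 {0} _ = inj₁ refl
below-mod₃ 0 {suc h} (s≤s ())
below-mod₃ 1 {0} _ = inj₂ (0 , refl , refl)
below-mod₃ 1 {1} _ = inj₁ refl
below-mod₃ 1 {suc (suc h)} (s≤s (s≤s ()))
below-mod₃ 2 ()
below-mod₃ (suc (suc (suc n))) h< with below-mod₃ n h<
... | inj₁ eq = inj₁ eq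
... | inj₂ (m , refl , eq) = inj₂ (suc (suc (suc m)) , refl , eq)

module _ {V : Set} where

  cut-root-alone : ∀ {r : V} → Cut (r ∷ []) [] (r ∷ []) [] []
  cut-root-alone {r} = record
    { R = [] ; q = r ; perm = ↭-refl ; eperm = ↭-refl ; touch = λ () ; funnel = λ () ; inside = λ () }

  cut-root : ∀ {r x : V} {us} →
             Cut (r ∷ labels (node x us ∷ [])) (edges r (node x us ∷ [])) (r ∷ []) (x ∷ labels us) (edges x us)
  cut-root {r} {x} {us} = record
    { R = (r , x) ∷ [] ; q = x
    ; perm = ↭-prep r (↭-prep x (↭-identityʳ _))
    ; eperm = ↭-prep _ (↭-identityʳ _)
    ; touch = λ { (here refl) → inj₁ (here refl) }
    ; funnel = λ { (here refl) → (λ u∉ → ⊥-elim (u∉ (here refl))) , λ _ → refl }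
    ; inside = λ e → source∈ us e , there (target∈ e) }

  cut-root-pair-alone : ∀ {r x : V} → let ts = node x [] ∷ [] in Cut (r ∷ labels ts) (edges r ts) (r ∷ x ∷ []) [] []
  cut-root-pair-alone {r} {x} = record
    { R = (r , x) ∷ [] ; q = r ; perm = ↭-refl ; eperm = ↭-refl
    ; touch = λ { (here refl) → inj₁ (here refl) }
    ; funnel = λ { (here refl) → (λ _ → refl) , λ v∉ → ⊥-elim (v∉ (there (here refl))) }
    ; inside = λ () }

  cut-root-pair : ∀ {r x y : V} {vs} → let ts = node x (node y vs ∷ []) ∷ [] in
                  Cut (r ∷ labels ts) (edges r ts) (r ∷ x ∷ []) (y ∷ labels vs) (edges y vs)
  cut-root-pair {r} {x} {y} {vs} = record
    { R = (r , x) ∷ (x , y) ∷ [] ; q = y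
    ; perm = ↭-prep r (↭-prep x (↭-trans (↭-identityʳ _) (↭-prep y (↭-identityʳ _))))
    ; eperm = ↭-prep _ (↭-trans (↭-identityʳ _) (↭-prep _ (↭-identityʳ _)))
    ; touch = λ { (here refl) → inj₁ (here refl) ; (there (here refl)) → inj₁ (there (here refl)) }
    ; funnel = λ { (here refl) → (λ u∉ → ⊥-elim (u∉ (here refl))) , (λ v∉ → ⊥-elim (v∉ (there (here refl))))
                 ; (there (here refl)) → (λ u∉ → ⊥-elim (u∉ (there (here refl)))) , λ _ → refl }
    ; inside = λ e → source∈ vs e , there (target∈ e) }

-- Grundy values of positions

module Positions (G : Graph) (forest : IsForest G) where
  open Graph G using (n)

  V : Set
  V = Fin n

  -- The position A is the graph with vertices L and edges es, and k is enough
  -- fuel to evaluate it.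
  record Shows (k : ℕ) (A : VSet G) (L : List V) (es : List (V × V)) : Set where
    field
      size   : length L ≤ k
      unique : Unique L
      to     : ∀ {v} → A v → v ∈ L
      from   : ∀ {v} → v ∈ L → A v
      inside : ∀ {u v} → (u , v) ∈ es → u ∈ L × v ∈ L
      linked : ∀ {u v} → A u → A v → Adj G u v → Link es u v
      joined : ∀ {u v} → (u , v) ∈ es → Adj G u v

  link-adj : ∀ {k A L es u v} → Shows k A L es → Link es u v → Adj G u v
  link-adj S (inj₁ e) = Shows.joined S e
  link-adj {u = u} {v} S (inj₂ e) = adj-sym {G} {v} {u} (Shows.joined S e)

  link-end : ∀ {k A L es u v} → Shows k A L es → Link es u v → A v
  link-end S (inj₁ e) = Shows.from S (proj₂ (Shows.inside S e))
  link-end S (inj₂ e) = Shows.from S (proj₁ (Shows.inside S e))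

  candidate-nonempty : ∀ {L L' : List V} {es xs} → Candidate L es xs → length L' < length (xs ++ L')
  candidate-nonempty (one _) = s≤s (m≤n+m _ 0)
  candidate-nonempty (two _) = s≤s (m≤n+m _ 1)

  shows-after : ∀ {k A L es xs L' es' X} → Shows (suc k) A L es → Candidate L es xs →
                (∀ {v} → InX G X v → v ∈ xs) → (∀ {v} → v ∈ xs → InX G X v) →
                Cut L es xs L' es' → Shows k (remove G A X) L' es'
  shows-after {A = A} {es = es} {xs} {L'} {es'} {X} S cand X⊆ ⊆X cut = record
    { size   = s≤s⁻¹ (≤-trans (≤-trans (candidate-nonempty cand) (≤-reflexive (sym (↭-length perm)))) size)
    ; unique = proj₁ (proj₂ split)
    ; to     = λ (Av , v∉) → [ (λ v∈ → ⊥-elim (v∉ (⊆X v∈))) , (λ v∈ → v∈) ]′ (∈-++⁻ xs (∈-resp-↭ perm (to Av)))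
    ; from   = λ v∈ → from (∈-resp-↭ (↭-sym perm) (∈-++⁺ʳ xs v∈)) , λ v∈X → proj₂ (proj₂ split) (X⊆ v∈X) v∈
    ; inside = Cut.inside cut
    ; linked = linked'
    ; joined = λ e → joined (∈-resp-↭ (↭-sym eperm) (∈-++⁺ʳ R e))
    }
    where
    open Shows S
    open Cut cut hiding (inside)
    split = unique-++⁻ xs (unique-↭ perm unique)
    keep : ∀ {u v} → ¬ InX G X u → ¬ InX G X v → (u , v) ∈ es → (u , v) ∈ es'
    keep u∉ v∉ e with ∈-++⁻ R (∈-resp-↭ eperm e)
    ... | inj₂ e' = e'
    ... | inj₁ r  = ⊥-elim ([ (λ u∈ → u∉ (⊆X u∈)) , (λ v∈ → v∉ (⊆X v∈)) ]′ (touch r))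
    linked' : ∀ {u v} → remove G A X u → remove G A X v → Adj G u v → Link es' u v
    linked' (Au , u∉) (Av , v∉) a with linked Au Av a
    ... | inj₁ e = inj₁ (keep u∉ v∉ e)
    ... | inj₂ e = inj₂ (keep v∉ u∉ e)

  fromMove : ∀ {k A L es} → Shows (suc k) A L es → (m : Move G A) →
             ∃ λ xs → Candidate L es xs × Narrow es xs ×
                      (∀ {L' es'} → Cut L es xs L' es' → Shows k (after G A m) L' es')
  fromMove {k} {A} {L} {es} S (X , valid , ok) = let xs , cand , X⊆ , ⊆X = candidate X valid in
    xs , cand , narrow X⊆ ⊆X , shows-after S cand X⊆ ⊆X
    where
    open Shows S
    candidate : ∀ X → ValidX G A X → ∃ λ xs → Candidate L es xs ×
                (∀ {v} → InX G X v → v ∈ xs) × (∀ {v} → v ∈ xs → InX G X v)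
    candidate (single x) Ax = _ , one (to Ax) , here , ∈₁⁻
    candidate (pair x y) (Ax , Ay , _ , a) with linked Ax Ay a
    ... | inj₁ e = _ , two e , (λ { (inj₁ eq) → here eq ; (inj₂ eq) → there (here eq) }) , ∈₂⁻
    ... | inj₂ e = _ , two e , (λ { (inj₁ eq) → there (here eq) ; (inj₂ eq) → here eq }) , λ v∈ → swap (∈₂⁻ v∈)
    narrow : ∀ {xs} → (∀ {v} → InX G X v → v ∈ xs) → (∀ {v} → v ∈ xs → InX G X v) → Narrow es xs
    narrow {xs} X⊆ ⊆X ou ow = compOK⇒boundary forest valid ok (boundary ou) (boundary ow)
      where
      boundary : ∀ {u} → Outside es xs u → Boundary A X u
      boundary (u∉ , x , x∈ , l) = link-end S l , (λ u∈ → u∉ (X⊆ u∈)) , x , ⊆X x∈ , link-adj S l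

  toMove : ∀ {k A L es xs L' es'} → Shows (suc k) A L es → Candidate L es xs → Cut L es xs L' es' →
           Σ (Move G A) λ m → Shows k (after G A m) L' es'
  toMove {k} {A} {L} {es} S cand cut with candidate cand
    where
    open Shows S
    candidate : ∀ {xs} → Candidate L es xs → ∃ λ X → (Unique xs → ValidX G A X) ×
                (∀ {v} → InX G X v → v ∈ xs) × (∀ {v} → v ∈ xs → InX G X v)
    candidate (one x∈) = single _ , (λ _ → from x∈) , here , ∈₁⁻
    candidate (two e) = pair _ _ ,
      (λ u → from (proj₁ (inside e)) , from (proj₂ (inside e)) , unique-head u (here refl) , joined e) ,
      (λ { (inj₁ eq) → here eq ; (inj₂ eq) → there (here eq) }) , ∈₂⁻
  ... | X , valid , X⊆ , ⊆X =
    (X , valid (proj₁ (unique-++⁻ _ (unique-↭ (Cut.perm cut) unique))) ,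
     boundary⇒compOK λ bu bw → cut⇒narrow unique cut (outside bu) (outside bw)) ,
    shows-after S cand X⊆ ⊆X cut
    where
    open Shows S
    outside : ∀ {u} → Boundary A X u → Outside es _ u
    outside (Au , u∉ , x , x∈ , a) = (λ u∈ → u∉ (⊆X u∈)) , x , X⊆ x∈ ,
      linked (from (∈-resp-↭ (↭-sym (Cut.perm cut)) (∈-++⁺ˡ (X⊆ x∈)))) Au a

  -- Quantifying over `A` replaces extensionality: predicates arising from different moves need not
  -- be equal, only described by the same lists.
  Value : ℕ → List V → List (V × V) → ℕ → Set₁
  Value k L es g = ∀ {A} → Shows k A L es → IsGrundyF G k A g

  value-empty : ∀ k → Value k [] [] 0
  value-empty zero    S = refl
  value-empty (suc k) S = (λ m _ → no-move m) , λ h ()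
    where
    no-move : ¬ Move G _
    no-move (single x , Ax , _) with () ← Shows.to S Ax
    no-move (pair x y , (Ax , _) , _) with () ← Shows.to S Ax

  -- Inductions run on the fuel. With none left, `size` rules out a non-empty position, so their
  -- base case is vacuous.
  value-zero : ∀ {x L es g} → Value zero (x ∷ L) es g
  value-zero S with () ← Shows.size S

  Excluded : ℕ → List V → List (V × V) → List V → ℕ → Set₁
  Excluded k L es xs g = ∃₂ λ L' es' → Cut L es xs L' es' × ∃ λ h → Value k L' es' h × g ≢ h

  Reached : ℕ → List V → List (V × V) → ℕ → Set₁
  Reached k L es h = ∃ λ xs → ∃₂ λ L' es' → Candidate L es xs × Cut L es xs L' es' × Value k L' es' h

  -- The mex rule in list form. Exclusion starts from a legal move, hence from a narrow candidate;
  -- reaching a value has to build the move, hence supplies a cut.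
  value-step : ∀ {k L es g} →
    (∀ {xs} → Unique L → Candidate L es xs → Narrow es xs → Excluded k L es xs g) →
    (∀ {h} → h < g → Reached k L es h) →
    Value (suc k) L es g
  value-step {k} excluded reached S =
    (λ m gm → let xs , cand , nw , shows = fromMove S m
                  L' , es' , cut , h , val , g≢h = excluded (Shows.unique S) cand nw
              in g≢h (grundy-unique k gm (val (shows cut)))) ,
    λ h h<g → let xs , L' , es' , cand , cut , val = reached h<g
                  m , S' = toMove S cand cut
              in m , val S'

  TreeValue : ℕ → Tree → ℕ → Set₁
  TreeValue k (node r ts) g = Value k (r ∷ labels ts) (edges r ts) g

  prune-step : ∀ {k r ts g} →
    (∀ {xs} → Unique (r ∷ labels ts) → Candidate (r ∷ labels ts) (edges r ts) xs → Narrow (edges r ts) xs → r ∉ xs) →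
    (∀ {R ts'} → Prune r ts R ts' → ∃ λ h → TreeValue k (node r ts') h × g ≢ h) →
    (∀ {h} → h < g → ∃₂ λ R ts' → Prune r ts R ts' × TreeValue k (node r ts') h) →
    TreeValue (suc k) (node r ts) g
  prune-step {k} {r} {ts} {g} blocked excluded reached = value-step excluded'
    λ h<g → let R , ts' , π , val = reached h<g in _ , _ , _ , prune-candidate π , prune-cut π , val
    where
    excluded' : ∀ {xs} → Unique (r ∷ labels ts) → Candidate (r ∷ labels ts) (edges r ts) xs → Narrow (edges r ts) xs →
                Excluded k (r ∷ labels ts) (edges r ts) xs g
    excluded' uniq cand nw with prune-classify uniq cand nw
    ... | inj₁ r∈ = ⊥-elim (blocked uniq cand nw r∈)
    ... | inj₂ (R , ts' , π , refl) = _ , _ , prune-cut π , excluded π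

  -- Only undirected links matter, so values pass between rooted presentations of the same graph.
  value-resp : ∀ {k L es L' es' g} → L ↭ L' → (∀ {u v} → (u , v) ∈ es → Link es' u v) →
               (∀ {u v} → (u , v) ∈ es' → Link es u v) → Value k L' es' g → Value k L es g
  value-resp {es' = es'} p there' back val S = val record
    { size   = ≤-trans (≤-reflexive (sym (↭-length p))) size
    ; unique = unique-↭ p unique
    ; to     = λ Av → ∈-resp-↭ p (to Av)
    ; from   = λ v∈ → from (∈-resp-↭ (↭-sym p) v∈)
    ; inside = λ e → ∈-resp-↭ p (to (link-end S (swap (back e)))) , ∈-resp-↭ p (to (link-end S (back e)))
    ; linked = λ Au Av a → relink (linked Au Av a)
    ; joined = λ e → link-adj S (back e)
    }
    where
    open Shows S
    relink : ∀ {u v} → Link _ u v → Link es' u v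
    relink (inj₁ e) = there' e
    relink (inj₂ e) = swap (there' e)

  reroot : ∀ {k g} x y us ts → TreeValue k (node y (node x ts ∷ us)) g → TreeValue k (node x (node y us ∷ ts)) g
  reroot x y us ts = value-resp
    (↭-swap x y (++-comm (labels us) (labels ts)))
    (flip (edges y us) (edges x ts)) (flip (edges x ts) (edges y us))
    where
    flip : ∀ {x y : V} es fs {u v} → (u , v) ∈ (x , y) ∷ es ++ fs → Link ((y , x) ∷ fs ++ es) u v
    flip es fs (here refl) = inj₂ (here refl)
    flip es fs (there e) with ∈-++⁻ es e
    ... | inj₁ e' = inj₁ (there (∈-++⁺ʳ fs e'))
    ... | inj₂ e' = inj₁ (there (∈-++⁺ˡ e'))

  swap-children : ∀ {k g} r s t → TreeValue k (node r (t ∷ s ∷ [])) g → TreeValue k (node r (s ∷ t ∷ [])) g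
  swap-children r (node x us) (node y vs) = value-resp
    (↭-prep r (exchange (x ∷ labels us) (y ∷ labels vs)))
    (λ e → inj₁ (∈-resp-↭ p e)) (λ e → inj₁ (∈-resp-↭ (↭-sym p) e))
    where
    exchange : ∀ {A : Set} (xs ys : List A) → xs ++ ys ++ [] ↭ ys ++ xs ++ []
    exchange xs ys = shifts xs ys
    p = exchange ((r , x) ∷ edges x us) ((r , y) ∷ edges y vs)

  -- The path is rooted at an end: moves at the far end are prunes, moves at the near end are root
  -- cuts, and these reach all smaller values.
  value-path : ∀ k {t l} → Chain t l → TreeValue k t (mod₃ l)
  value-path zero end = value-zero
  value-path zero (link _) = value-zero
  value-path (suc k) (end {r}) = value-step excluded
    λ { {zero} _ → _ , _ , _ , one (here refl) , cut-root-alone , value-empty k ; {suc _} (s≤s ()) }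
    where
    excluded : ∀ {xs} → Unique (r ∷ []) → Candidate (r ∷ []) [] xs → Narrow [] xs → Excluded k (r ∷ []) [] xs 1
    excluded _ (one (here refl)) _ = _ , _ , cut-root-alone , 0 , value-empty k , λ ()
  value-path (suc k) (link {r} {node x us} {l} a) = value-step excluded reached
    where
    L = r ∷ labels (node x us ∷ [])
    es = edges r (node x us ∷ [])
    shortened : ∀ {ts' ls'} → Arms ts' ls' → Shorten (l ∷ []) ls' →
                ∃ λ h → TreeValue k (node r ts') h × mod₃ (suc l) ≢ h
    shortened [] drop₁ = _ , value-path k end , λ ()
    shortened [] drop₂ = _ , value-path k end , λ ()
    shortened (a ∷ []) (less₁ {m}) = _ , value-path k (link a) , mod₃-suc≢ (2 + m)
    shortened (a ∷ []) (less₂ {m}) = _ , value-path k (link a) , mod₃-2+≢ (2 + m)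

    root-pair : ∀ {us l} → Chain (node x us) l → ∃₂ λ L' es' →
                Cut (r ∷ labels (node x us ∷ [])) (edges r (node x us ∷ [])) (r ∷ x ∷ []) L' es' ×
                ∃ λ m → Value k L' es' (mod₃ m) × l ≡ suc m
    root-pair end = _ , _ , cut-root-pair-alone , 0 , value-empty k , refl
    root-pair (link {t = node y vs} {m} b) = _ , _ , cut-root-pair , m , value-path k b , refl

    rooted : ∀ {xs} → Unique L → Candidate L es xs → r ∈ xs → Excluded k L es xs (mod₃ (suc l))
    rooted _ (one _) (here refl) = _ , _ , cut-root , _ , value-path k a , mod₃-suc≢ l
    rooted _ (two (here refl)) _ with root-pair a
    ... | _ , _ , cut , m , val , refl = _ , _ , cut , _ , val , mod₃-2+≢ m
    rooted uniq (two (there e)) r∈ with ∈-++⁻ (edges x us) e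
    ... | inj₁ e' with r∈
    ...   | here refl = ⊥-elim (unique-head uniq (∈-++⁺ˡ {xs = x ∷ labels us} (source∈ us e')) refl)
    ...   | there (here refl) = ⊥-elim (unique-head uniq (there (∈-++⁺ˡ (target∈ e'))) refl)

    excluded : ∀ {xs} → Unique L → Candidate L es xs → Narrow es xs → Excluded k L es xs (mod₃ (suc l))
    excluded uniq cand nw with prune-classify uniq cand nw
    ... | inj₁ r∈ = rooted uniq cand r∈
    ... | inj₂ (R , ts' , π , refl) = let ls' , as , s = prune-arms π (a ∷ []) in
      _ , _ , prune-cut π , shortened as s

    reached : ∀ {h} → h < mod₃ (suc l) → Reached k L es h
    reached h< with below-mod₃ l h<
    ... | inj₁ refl = _ , _ , _ , one (here refl) , cut-root , value-path k a
    ... | inj₂ (m , eq , refl) with root-pair a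
    ...   | _ , _ , cut , m' , val , eq' with refl ← trans (sym eq) eq' =
      _ , _ , _ , two (here refl) , cut , val

  -- A star with two arms is a path: reroot it step by step down the first arm.
  value-two-arms : ∀ k {r s t l m} → Chain s l → Chain t m → TreeValue k (node r (s ∷ t ∷ [])) (mod₃ (suc (l + m)))
  value-two-arms k {r} {t = t} (end {x}) b = reroot r x [] (t ∷ []) (value-path k (link (link b)))
  value-two-arms k {r} {t = t} {m = m} (link {x} {s} {l} a) b = reroot r x (s ∷ []) (t ∷ [])
    (swap-children x (node r (t ∷ [])) s
      (subst (λ j → TreeValue k (node x (s ∷ node r (t ∷ []) ∷ [])) (mod₃ (suc j))) (+-suc l m)
        (value-two-arms k a (link b))))

-- Classes of stars and the finite verification

-- Only parity matters from `a = 2` and from `b = 4` on. A profile also looks at one arm fewer, so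
-- its period starts one later.
cap₂ cap₄ : ℕ → ℕ
cap₂ (suc (suc (suc (suc n)))) = cap₂ (suc (suc n))
cap₂ n = n
cap₄ (suc (suc (suc (suc (suc (suc n)))))) = cap₄ (suc (suc (suc (suc n))))
cap₄ n = n

-- Entry (a , b) is the class of the star with a arms of length 1 and b of length 2.
classTable : ℕ → ℕ → Cls
classTable 0 0 = D1*
classTable 1 0 = D2*
classTable 2 0 = D0*
classTable _ 0 = D1□
classTable 0 1 = D0*
classTable 1 1 = D1*
classTable 2 1 = D2□
classTable _ 1 = D3□
classTable 0 2 = D2*
classTable 1 2 = D0*
classTable 2 2 = D1□
classTable _ 2 = D0*
classTable 0 3 = D1*
classTable 1 3 = D2□
classTable 2 3 = D3□
classTable _ 3 = D2□
classTable 0 4 = D0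
classTable 1 4 = D1
classTable 2 4 = D0
classTable _ 4 = D1
classTable 0 _ = D2
classTable 1 _ = D3
classTable 2 _ = D2
classTable _ _ = D3

cls : ℕ → ℕ → Cls
cls a b = classTable (cap₂ a) (cap₄ b)

value : Cls → ℕ
value D0  = 0
value D0* = 0
value D1  = 1
value D1* = 1
value D1□ = 1
value D2  = 2
value D2* = 2
value D2□ = 2
value D3  = 3
value D3□ = 3

opaque
  -- Opaque, so that comparing types does not unfold the table; the finite checks unfold it locally.
  _⊙_ : Cls → Cls → ℕ
  C ⊙ C' = evalEntry (table C C') (value C) (value C')

  ⊙-def : ∀ C C' → evalEntry (table C C') (value C) (value C') ≡ C ⊙ C'
  ⊙-def C C' = refl

-- Moves shortening an arm of residue 1 or 2 mod 3, and one of residue 0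
-- when a + b ≤ z guarantees such an arm (the star then has more than z arms).
options₁ options₂ : ℕ → ℕ → List (ℕ × ℕ)
options₁ zero    b = []
options₁ (suc a) b = (a , b) ∷ []
options₂ a zero    = []
options₂ a (suc b) = (a , b) ∷ (suc a , b) ∷ []

options₀ : Bool → ℕ → ℕ → List (ℕ × ℕ)
options₀ true  a b = (suc a , b) ∷ (a , suc b) ∷ []
options₀ false a b = []

options : ℕ → ℕ → ℕ → List (ℕ × ℕ)
options z a b = options₁ a b ++ options₂ a b ++ options₀ (a + b ≤ᵇ z) a b

cls′ : ℕ × ℕ → Cls
cls′ (a , b) = cls a b

-- All the finite checks need to know about (a , b).  It has period 2 in a from
-- a = 3 on and in b from b = 5 on, so 5 × 7 pairs decide everything.
record Profile : Set where
  constructor profile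
  field
    this with1 with2 : Cls
    starMoves bistarMoves : List Cls

profileOf : ℕ → ℕ → Profile
profileOf a b = profile (cls a b) (cls (suc a) b) (cls a (suc b))
                        (map cls′ (options 2 a b)) (map cls′ (options 1 a b))

small₅ : ℕ → Fin 5
small₅ 0 = zero
small₅ 1 = suc zero
small₅ 2 = suc (suc zero)
small₅ 3 = suc (suc (suc zero))
small₅ 4 = suc (suc (suc (suc zero)))
small₅ (suc (suc (suc (suc (suc n))))) = small₅ (suc (suc (suc n)))

small₇ : ℕ → Fin 7
small₇ 0 = zero
small₇ 1 = suc zero
small₇ 2 = suc (suc zero)
small₇ 3 = suc (suc (suc zero))
small₇ 4 = suc (suc (suc (suc zero)))
small₇ 5 = suc (suc (suc (suc (suc zero))))
small₇ 6 = suc (suc (suc (suc (suc (suc zero)))))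
small₇ (suc (suc (suc (suc (suc (suc (suc n))))))) = small₇ (suc (suc (suc (suc (suc n)))))

profile-period-a : ∀ a b → profileOf (5 + a) b ≡ profileOf (3 + a) b
profile-period-a a zero    = refl
profile-period-a a (suc b) = refl

-- The cases let `options₁` and the test `a + b ≤ᵇ z` evaluate; three known successors already
-- exceed both bounds 1 and 2.
profile-period-b : ∀ a b → profileOf a (7 + b) ≡ profileOf a (5 + b)
profile-period-b 0 b = refl
profile-period-b 1 b = refl
profile-period-b 2 b = refl
profile-period-b (suc (suc (suc a))) b = refl

profile-small-b : ∀ a b → profileOf a b ≡ profileOf a (toℕ (small₇ b))
profile-small-b a 0 = refl
profile-small-b a 1 = refl
profile-small-b a 2 = refl
profile-small-b a 3 = refl
profile-small-b a 4 = refl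
profile-small-b a 5 = refl
profile-small-b a 6 = refl
profile-small-b a (suc (suc (suc (suc (suc (suc (suc b))))))) =
  trans (profile-period-b a b) (profile-small-b a (suc (suc (suc (suc (suc b))))))

profile-small : ∀ a b → profileOf a b ≡ profileOf (toℕ (small₅ a)) (toℕ (small₇ b))
profile-small 0 b = profile-small-b 0 b
profile-small 1 b = profile-small-b 1 b
profile-small 2 b = profile-small-b 2 b
profile-small 3 b = profile-small-b 3 b
profile-small 4 b = profile-small-b 4 b
profile-small (suc (suc (suc (suc (suc a))))) b = trans (profile-period-a a b) (profile-small (suc (suc (suc a))) b)

classes : List Cls
classes = D0 ∷ D0* ∷ D1 ∷ D1* ∷ D1□ ∷ D2 ∷ D2* ∷ D2□ ∷ D3 ∷ D3□ ∷ []

∈-classes : ∀ C → C ∈ classes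
∈-classes D0  = here refl
∈-classes D0* = there (here refl)
∈-classes D1  = there (there (here refl))
∈-classes D1* = there (there (there (here refl)))
∈-classes D1□ = there (there (there (there (here refl))))
∈-classes D2  = there (there (there (there (there (here refl)))))
∈-classes D2* = there (there (there (there (there (there (here refl))))))
∈-classes D2□ = there (there (there (there (there (there (there (here refl)))))))
∈-classes D3  = there (there (there (there (there (there (there (there (here refl))))))))
∈-classes D3□ = there (there (there (there (there (there (there (there (there (here refl)))))))))

allClasses? : ∀ {P : Cls → Set} → (∀ C → Dec (P C)) → Dec (∀ C → P C)
allClasses? P? = map′ (λ ps C → All.lookup ps (∈-classes C)) (λ p → All.tabulate λ {C} _ → p C) (All.all? P? classes)

smallProfiles? : ∀ {P : Profile → Set} → (∀ p → Dec (P p)) →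
                 Dec (∀ (a : Fin 5) (b : Fin 7) → P (profileOf (toℕ a) (toℕ b)))
smallProfiles? P? = all? λ a → all? λ b → P? (profileOf (toℕ a) (toℕ b))

-- The implicit argument is solved by running the decision on the 35 small profiles.
allProfiles : ∀ {P : Profile → Set} (P? : ∀ p → Dec (P p)) {_ : True (smallProfiles? P?)} →
              ∀ a b → P (profileOf a b)
allProfiles {P} P? {ok} a b = subst P (sym (profile-small a b)) (toWitness ok (small₅ a) (small₇ b))

opaque
  unfolding _⊙_

  ⊙-comm : ∀ C C' → C ⊙ C' ≡ C' ⊙ C
  ⊙-comm = from-yes (allClasses? λ C → allClasses? λ C' → C ⊙ C' ≟ℕ C' ⊙ C)

_#_ : Cls → Cls → Set
C # C' = value C ≢ value C' × ∀ D → C ⊙ D ≢ C' ⊙ D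

_#?_ : ∀ C C' → Dec (C # C')
C #? C' = ¬? (value C ≟ℕ value C') ×-dec allClasses? λ D → ¬? (C ⊙ D ≟ℕ C' ⊙ D)

-- The exclusion half of mex: the three classes arise from giving one arm residue 0, 1 or 2 over the
-- same other arms. `_#_` asks for difference against every `D` because the other side of a bistar
-- is arbitrary.
Separated : Profile → Set
Separated (profile C C₁ C₂ _ _) = C # C₁ × C # C₂ × C₁ # C₂

opaque
  unfolding _⊙_

  separated : ∀ a b → Separated (profileOf a b)
  separated = allProfiles {Separated} λ _ → (_ #? _) ×-dec ((_ #? _) ×-dec (_ #? _))

StarReach : Profile → Set
StarReach (profile C _ _ Ms _) = All (_∈ map value Ms) (downFrom (value C))

starReach : ∀ a b → StarReach (profileOf a b)
starReach = allProfiles {StarReach} λ _ → All.all? (_∈? _) _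

BistarReach : Profile → Profile → Set
BistarReach (profile C _ _ _ Ms) (profile C' _ _ _ Ms') =
  All (_∈ map (_⊙ C') Ms ++ map (C ⊙_) Ms') (downFrom (C ⊙ C'))

opaque
  unfolding _⊙_

  bistarReach : ∀ a b a' b' → BistarReach (profileOf a b) (profileOf a' b')
  -- The second pair is reduced here and the first by `allProfiles`, leaving 35 times 35
  -- evaluations.
  bistarReach a b a' b' = subst (BistarReach (profileOf a b)) (sym (profile-small a' b'))
    (allProfiles {λ p → ∀ c d → BistarReach p (profileOf (toℕ c) (toℕ d))}
      (λ p → smallProfiles? {BistarReach p} λ _ → All.all? (_∈? _) _) a b (small₅ a') (small₇ b'))

-- A side that is a centre with one arm of length `n` hangs on the other centre as an arm of length
-- `n + 2`. For `n` = 0, 1, 2 the rows are those of `P₁`, `S₁`, `S₂`, and the new arm has residue 2,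
-- 0, 1.
Hanging : Profile → Set
Hanging (profile C C₁ C₂ _ _) = value C₂ ≡ D1* ⊙ C × value C ≡ D2* ⊙ C × value C₁ ≡ D0* ⊙ C

opaque
  unfolding _⊙_

  hanging : ∀ a b → Hanging (profileOf a b)
  hanging = allProfiles {Hanging} λ _ → (_ ≟ℕ _) ×-dec ((_ ≟ℕ _) ×-dec (_ ≟ℕ _))

-- Residue counts of arms and the moves they guarantee

residue : ℕ → Fin 3
residue 0 = zero
residue 1 = suc zero
residue 2 = suc (suc zero)
residue (suc (suc (suc n))) = residue n

add : Fin 3 → ℕ × ℕ → ℕ × ℕ
add zero s             = s
add (suc zero) s       = suc (proj₁ s) , proj₂ s
add (suc (suc zero)) s = proj₁ s , suc (proj₂ s)

count : List ℕ → ℕ × ℕ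
count []       = 0 , 0
count (n ∷ ls) = add (residue n) (count ls)

class : List ℕ → Cls
class ls = cls′ (count ls)

add-injective : ∀ i {s s'} → add i s ≡ add i s' → s ≡ s'
add-injective zero refl = refl
add-injective (suc zero) refl = refl
add-injective (suc (suc zero)) refl = refl

add-comm : ∀ i j s → add i (add j s) ≡ add j (add i s)
add-comm zero j s = refl
add-comm i@(suc _) zero s = refl
add-comm (suc zero) (suc zero) s = refl
add-comm (suc zero) (suc (suc zero)) s = refl
add-comm (suc (suc zero)) (suc zero) s = refl
add-comm (suc (suc zero)) (suc (suc zero)) s = refl

residue-suc≢ : ∀ n → residue (suc n) ≢ residue n
residue-suc≢ 0 ()
residue-suc≢ 1 ()
residue-suc≢ 2 ()
residue-suc≢ (suc (suc (suc n))) = residue-suc≢ n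

-- Here `s` counts the untouched arms, and an arm that disappears is booked as residue 0.
shorten-count : ∀ {ls ls'} → Shorten ls ls' → ∃₂ λ i j → ∃ λ s → i ≢ j × count ls ≡ add i s × count ls' ≡ add j s
shorten-count {_} {ls} drop₁ = suc zero , zero , count ls , (λ ()) , refl , refl
shorten-count {_} {ls} drop₂ = suc (suc zero) , zero , count ls , (λ ()) , refl , refl
shorten-count (less₁ {n} {ls}) = _ , _ , count ls , residue-suc≢ (suc n) , refl , refl
shorten-count (less₂ {n} {ls}) = _ , _ , count ls , (λ eq → residue-suc≢ n (sym eq)) , refl , refl
shorten-count (later {n} σ) with shorten-count σ
... | i , j , s , i≢j , eq , eq' = i , j , add (residue n) s , i≢j ,
  trans (cong (add (residue n)) eq) (add-comm (residue n) i s) ,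
  trans (cong (add (residue n)) eq') (add-comm (residue n) j s)

#-sym : ∀ {C C'} → C # C' → C' # C
#-sym (v , f) = (λ eq → v (sym eq)) , λ D eq → f D (sym eq)

add-# : ∀ i j s → i ≢ j → cls′ (add i s) # cls′ (add j s)
add-# zero zero s i≢j = ⊥-elim (i≢j refl)
add-# zero (suc zero) (a , b) _ = proj₁ (separated a b)
add-# zero (suc (suc zero)) (a , b) _ = proj₁ (proj₂ (separated a b))
add-# (suc zero) zero (a , b) _ = #-sym {cls a b} (proj₁ (separated a b))
add-# (suc zero) (suc zero) s i≢j = ⊥-elim (i≢j refl)
add-# (suc zero) (suc (suc zero)) (a , b) _ = proj₂ (proj₂ (separated a b))
add-# (suc (suc zero)) zero (a , b) _ = #-sym {cls a b} (proj₁ (proj₂ (separated a b)))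
add-# (suc (suc zero)) (suc zero) (a , b) _ = #-sym {cls (suc a) b} (proj₂ (proj₂ (separated a b)))
add-# (suc (suc zero)) (suc (suc zero)) s i≢j = ⊥-elim (i≢j refl)

shorten-# : ∀ {ls ls'} → Shorten ls ls' → class ls # class ls'
shorten-# σ with shorten-count σ
... | i , j , s , i≢j , eq , eq' rewrite eq | eq' = add-# i j s i≢j

-- The changes of residue available to every arm of positive length. The change from 1 to 2 is
-- absent because it takes a length of at least 4.
data Allowed : Fin 3 → Fin 3 → Set where
  1→0 : Allowed (suc zero) zero
  2→0 : Allowed (suc (suc zero)) zero
  2→1 : Allowed (suc (suc zero)) (suc zero)
  0→1 : Allowed zero (suc zero)
  0→2 : Allowed zero (suc (suc zero))

succ₃ : Fin 3 → Fin 3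
succ₃ zero = suc zero
succ₃ (suc zero) = suc (suc zero)
succ₃ (suc (suc zero)) = zero

residue-suc : ∀ n → residue (suc n) ≡ succ₃ (residue n)
residue-suc 0 = refl
residue-suc 1 = refl
residue-suc 2 = refl
residue-suc (suc (suc (suc n))) = residue-suc n

shorten-arm : ∀ n {i j} ls → residue (suc n) ≡ i → Allowed i j →
              ∃ λ ls' → Shorten (suc n ∷ ls) ls' × count ls' ≡ add j (count ls)
shorten-arm 0 ls refl 1→0 = _ , drop₁ , refl
shorten-arm 1 ls refl 2→0 = _ , drop₂ , refl
shorten-arm 1 ls refl 2→1 = _ , less₁ , refl
shorten-arm 2 ls refl 0→1 = _ , less₂ , refl
shorten-arm 2 ls refl 0→2 = _ , less₁ , refl
shorten-arm (suc (suc (suc n))) ls eq ok =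
  -- From length 4 on, both shortenings keep the arm: one vertex less gives the residue of `n`, two
  -- less that of `2 + n`, and the wanted change decides between them.
  by (residue n) refl (trans (sym eq) (residue-suc n)) ok
  where
  less₁′ : ∀ {j} → residue n ≡ j → ∃ λ ls' → Shorten (4 + n ∷ ls) ls' × count ls' ≡ add j (count ls)
  less₁′ refl = _ , less₁ , refl
  less₂′ : ∀ {j} → succ₃ (succ₃ (residue n)) ≡ j → ∃ λ ls' → Shorten (4 + n ∷ ls) ls' × count ls' ≡ add j (count ls)
  less₂′ refl = _ , less₂ , cong (λ i → add i (count ls)) (trans (residue-suc (suc n)) (cong succ₃ (residue-suc n)))
  by : ∀ r {i j} → residue n ≡ r → i ≡ succ₃ r → Allowed i j →
       ∃ λ ls' → Shorten (4 + n ∷ ls) ls' × count ls' ≡ add j (count ls)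
  by zero             r refl 1→0 = less₁′ r
  by (suc zero)       r refl 2→0 = less₂′ (cong (λ i → succ₃ (succ₃ i)) r)
  by (suc zero)       r refl 2→1 = less₁′ r
  by (suc (suc zero)) r refl 0→1 = less₂′ (cong (λ i → succ₃ (succ₃ i)) r)
  by (suc (suc zero)) r refl 0→2 = less₁′ r

Has : Fin 3 → List ℕ → Set
Has i = Any λ n → residue n ≡ i

shorten-has : ∀ {i j ls} → All (1 ≤_) ls → Has i ls → Allowed i j →
              ∃ λ ls' → Shorten ls ls' × ∃ λ s → count ls ≡ add i s × count ls' ≡ add j s
shorten-has {ls = suc n ∷ ls} (_ ∷ _) (here refl) ok =
  let ls' , σ , eq = shorten-arm n ls refl ok in ls' , σ , count ls , refl , eq
shorten-has {i} {j} {n ∷ ls} (_ ∷ pos) (there has) ok =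
  let ls' , σ , s , eq , eq' = shorten-has pos has ok in
  n ∷ ls' , later σ , add (residue n) s ,
  trans (cong (add (residue n)) eq) (add-comm (residue n) i s) ,
  trans (cong (add (residue n)) eq') (add-comm (residue n) j s)

shorten-to : ∀ {i j ls s} → All (1 ≤_) ls → Has i ls → Allowed i j → count ls ≡ add i s →
             ∃ λ ls' → Shorten ls ls' × count ls' ≡ add j s
shorten-to {i} pos has ok eq with shorten-has pos has ok
... | ls' , σ , s' , eq₁ , eq₂ with refl ← add-injective i (trans (sym eq₁) eq) = ls' , σ , eq₂

has₁ : ∀ ls {a} → proj₁ (count ls) ≡ suc a → Has (suc zero) ls
has₁ (n ∷ ls) eq with residue n in r
... | zero           = there (has₁ ls eq)
... | suc zero       = here r
... | suc (suc zero) = there (has₁ ls eq)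

has₂ : ∀ ls {b} → proj₂ (count ls) ≡ suc b → Has (suc (suc zero)) ls
has₂ (n ∷ ls) eq with residue n in r
... | zero           = there (has₂ ls eq)
... | suc zero       = there (has₂ ls eq)
... | suc (suc zero) = here r

-- Each arm of residue 1 or 2 is counted once, so an excess of arms leaves one of residue 0.
has₀ : ∀ ls → proj₁ (count ls) + proj₂ (count ls) < length ls → Has zero ls
has₀ (n ∷ ls) lt with residue n in r
... | zero           = here r
... | suc zero       = there (has₀ ls (s≤s⁻¹ lt))
... | suc (suc zero) = there (has₀ ls (s≤s⁻¹ (subst (_< suc (length ls)) (+-suc (proj₁ (count ls)) _) lt)))

shorten-option : ∀ z {ls a b s} → All (1 ≤_) ls → z < length ls → count ls ≡ (a , b) → s ∈ options z a b →
                 ∃ λ ls' → Shorten ls ls' × count ls' ≡ s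
shorten-option z {ls} {a} {b} {s} pos long eq s∈ with ∈-++⁻ (options₁ a b) s∈
... | inj₁ m = from₁ a eq m
  where
  from₁ : ∀ a → count ls ≡ (a , b) → s ∈ options₁ a b → ∃ λ ls' → Shorten ls ls' × count ls' ≡ s
  from₁ (suc a) eq (here refl) = shorten-to pos (has₁ ls (cong proj₁ eq)) 1→0 eq
... | inj₂ m' with ∈-++⁻ (options₂ a b) m'
...   | inj₁ m = from₂ b eq m
  where
  from₂ : ∀ b → count ls ≡ (a , b) → s ∈ options₂ a b → ∃ λ ls' → Shorten ls ls' × count ls' ≡ s
  from₂ (suc b) eq (here refl)         = shorten-to pos (has₂ ls (cong proj₂ eq)) 2→0 eq
  from₂ (suc b) eq (there (here refl)) = shorten-to pos (has₂ ls (cong proj₂ eq)) 2→1 eq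
...   | inj₂ m = from₀ (a + b ≤ᵇ z) refl m
  where
  has : (a + b ≤ᵇ z) ≡ true → Has zero ls
  has ok = has₀ ls (≤-trans
    (s≤s (subst (λ s → proj₁ s + proj₂ s ≤ z) (sym eq) (≤ᵇ⇒≤ (a + b) z (subst T (sym ok) _)))) long)
  from₀ : ∀ ok → (a + b ≤ᵇ z) ≡ ok → s ∈ options₀ ok a b → ∃ λ ls' → Shorten ls ls' × count ls' ≡ s
  from₀ true ok (here refl)         = shorten-to pos (has ok) 0→1 eq
  from₀ true ok (there (here refl)) = shorten-to pos (has ok) 0→2 eq

shorten-reach : ∀ z (f : Cls → ℕ) {ls h} → All (1 ≤_) ls → z < length ls →
                h ∈ map f (map cls′ (options z (proj₁ (count ls)) (proj₂ (count ls)))) →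
                ∃ λ ls' → Shorten ls ls' × h ≡ f (class ls')
shorten-reach z f {ls} pos long h∈ =
  let C , C∈ , h≡ = ∈-map⁻ f h∈
      s , s∈ , C≡ = ∈-map⁻ cls′ C∈
      ls' , σ , s≡ = shorten-option z {ls} pos long refl s∈
  in ls' , σ , trans h≡ (cong f (trans C≡ (cong cls′ (sym s≡))))

star-reach : ∀ {ls h} → All (1 ≤_) ls → 2 < length ls → h < value (class ls) →
             ∃ λ ls' → Shorten ls ls' × h ≡ value (class ls')
star-reach {ls} pos long h< =
  shorten-reach 2 value pos long (All.lookup (starReach (proj₁ (count ls)) (proj₂ (count ls))) (∈-downFrom⁺ h<))

bistar-reach : ∀ {ls ms h} → All (1 ≤_) ls → All (1 ≤_) ms → 1 < length ls → 1 < length ms →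
               h < class ls ⊙ class ms →
               (∃ λ ls' → Shorten ls ls' × h ≡ class ls' ⊙ class ms) ⊎
               (∃ λ ms' → Shorten ms ms' × h ≡ class ls ⊙ class ms')
bistar-reach {ls} {ms} pos pos' long long' h< =
  Sum.map (shorten-reach 1 (_⊙ class ms) pos long) (shorten-reach 1 (class ls ⊙_) pos' long')
    (∈-++⁻ (map (_⊙ class ms) (map cls′ (options 1 (proj₁ (count ls)) (proj₂ (count ls)))))
      (All.lookup (bistarReach (proj₁ (count ls)) (proj₂ (count ls)) (proj₁ (count ms)) (proj₂ (count ms)))
        (∈-downFrom⁺ h<)))

one-arm-value : ∀ n → value (class (n ∷ [])) ≡ mod₃ (suc n)
one-arm-value 0 = refl
one-arm-value 1 = refl
one-arm-value 2 = refl
one-arm-value (suc (suc (suc n))) = one-arm-value n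

-- Stars with few arms also allow moves on the centre, so their table entries are checked against
-- the path values instead of by the mex of shortenings.
two-arms-value : ∀ m n → value (class (m ∷ n ∷ [])) ≡ mod₃ (suc (m + n))
two-arms-value 0 n = one-arm-value n
two-arms-value (suc (suc (suc m))) n = two-arms-value m n
two-arms-value 1 0 = refl
two-arms-value 1 1 = refl
two-arms-value 1 2 = refl
two-arms-value 1 (suc (suc (suc n))) = two-arms-value 1 n
two-arms-value 2 0 = refl
two-arms-value 2 1 = refl
two-arms-value 2 2 = refl
two-arms-value 2 (suc (suc (suc n))) = two-arms-value 2 n

hanging-value : ∀ n ls → value (class (2 + n ∷ ls)) ≡ class (n ∷ []) ⊙ class ls
hanging-value 0 ls = proj₁ (hanging (proj₁ (count ls)) (proj₂ (count ls)))
hanging-value 1 ls = proj₁ (proj₂ (hanging (proj₁ (count ls)) (proj₂ (count ls))))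
hanging-value 2 ls = proj₂ (proj₂ (hanging (proj₁ (count ls)) (proj₂ (count ls))))
hanging-value (suc (suc (suc n))) ls = hanging-value n ls

chain-positive : ∀ {V : Set} {t : Tree {V}} {n} → Chain t n → 1 ≤ n
chain-positive end      = s≤s z≤n
chain-positive (link _) = s≤s z≤n

arms-positive : ∀ {V : Set} {ts : List (Tree {V})} {ls} → Arms ts ls → All (1 ≤_) ls
arms-positive []       = []
arms-positive (a ∷ as) = chain-positive a ∷ arms-positive as

-- Values of stars and bistars with arbitrary arms

module _ (G : Graph) (forest : IsForest G) where
  open Positions G forest
  open RootBlocked {V} _≟_

  value-star : ∀ k {r ts ls} → Arms ts ls → TreeValue k (node r ts) (value (class ls))
  value-star zero _ = value-zero
  value-star (suc k) [] = value-path (suc k) end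
  value-star (suc k) (_∷_ {t} {n = n} a []) rewrite one-arm-value n = value-path (suc k) (link a)
  value-star (suc k) (_∷_ {n = m} a (_∷_ {n = n} b [])) rewrite two-arms-value m n = value-two-arms (suc k) a b
  value-star (suc k) {r} as@(a₁ ∷ a₂ ∷ a₃ ∷ as₀) = prune-step
    blocked₃
    (λ π → let ls' , as' , σ = prune-arms π as in _ , value-star k as' , proj₁ (shorten-# σ))
    λ h< → let ls' , σ , eq = star-reach (arms-positive as) (s≤s (s≤s (s≤s z≤n))) h<
               R , ts' , π , as' = arms-prune as σ
           in R , ts' , π , subst (TreeValue k (node r ts')) (sym eq) (value-star k as')

  -- Rooted at `c₂`, the bistar is a star in which `v` begins an arm of length `2 + n`.
  value-bistar-short : ∀ k {v c₁ c₂ us vs n ms} → Chain (node v (node c₁ us ∷ [])) (2 + n) → Arms vs ms →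
                       TreeValue k (node v (node c₁ us ∷ node c₂ vs ∷ [])) (class (n ∷ []) ⊙ class ms)
  value-bistar-short k {v} {c₁} {c₂} {us} {vs} {n} {ms} a bs =
    swap-children v (node c₁ us) (node c₂ vs)
      (reroot v c₂ vs (node c₁ us ∷ [])
        (subst (TreeValue k (node c₂ (node v (node c₁ us ∷ []) ∷ vs))) (hanging-value n ms) (value-star k (a ∷ bs))))

  BistarValue : ℕ → V → V → V → List Tree → List Tree → List ℕ → List ℕ → Set₁
  BistarValue k v c₁ c₂ us vs ls ms = TreeValue k (node v (node c₁ us ∷ node c₂ vs ∷ [])) (class ls ⊙ class ms)

  -- With two arms on each side no move touches `v` or a centre, so all moves are shortenings. One
  -- of them may leave a side with a single arm, hence `rec` covers all shapes.
  value-bistar-long : ∀ {k v c₁ c₂ us vs ls ms} →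
    (∀ {us vs ls ms} → Arms us ls → Arms vs ms → BistarValue k v c₁ c₂ us vs ls ms) →
    Arms us ls → 1 < length ls → Arms vs ms → 1 < length ms → BistarValue (suc k) v c₁ c₂ us vs ls ms
  value-bistar-long {k} {v} {c₁} {c₂} {us} {vs} {ls} {ms} rec as long bs long' =
    prune-step (blocked as long bs long') (λ π → excluded π as long bs long') reached
    where
    blocked : ∀ {us vs ls ms} → Arms us ls → 1 < length ls → Arms vs ms → 1 < length ms → ∀ {xs} →
              let ts = node c₁ us ∷ node c₂ vs ∷ [] in Unique (v ∷ labels ts) →
              Candidate (v ∷ labels ts) (edges v ts) xs → Narrow (edges v ts) xs → v ∉ xs
    blocked [] () _ _
    blocked _ _ [] ()
    blocked (_∷_ {t} {ts} _ _) _ (_∷_ {t'} {ts'} _ _) _ = blocked₂ {u₁ = ts} {s₂ = t'} {u₂ = ts'} {ts = []}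
    excluded : ∀ {us vs ls ms R ts'} → Prune v (node c₁ us ∷ node c₂ vs ∷ []) R ts' →
               Arms us ls → 1 < length ls → Arms vs ms → 1 < length ms →
               ∃ λ h → TreeValue k (node v ts') h × class ls ⊙ class ms ≢ h
    excluded leaf [] () _ _
    excluded leaf₂ (_ ∷ []) (s≤s ()) _ _
    excluded (next leaf) _ _ [] ()
    excluded (next leaf₂) _ _ (_ ∷ []) (s≤s ())
    excluded {ms = ms} (down π) as _ bs _ = let ls' , as' , σ = prune-arms π as in
      class ls' ⊙ class ms , rec as' bs , proj₂ (shorten-# σ) (class ms)
    excluded {ls = ls} {ms} (next (down π)) as _ bs _ = let ms' , bs' , σ = prune-arms π bs in
      class ls ⊙ class ms' , rec as bs' , λ eq → proj₂ (shorten-# σ) (class ls)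
        (trans (⊙-comm (class ms) (class ls)) (trans eq (⊙-comm (class ls) (class ms'))))
    reached : ∀ {h} → h < class ls ⊙ class ms →
              ∃₂ λ R ts' → Prune v (node c₁ us ∷ node c₂ vs ∷ []) R ts' × TreeValue k (node v ts') h
    reached h< with bistar-reach (arms-positive as) (arms-positive bs) long long' h<
    ... | inj₁ (ls' , σ , eq) = let R , us' , π , as' = arms-prune as σ in
      R , _ , down π , subst (TreeValue k (node v (node c₁ us' ∷ node c₂ vs ∷ []))) (sym eq) (rec as' bs)
    ... | inj₂ (ms' , σ , eq) = let R , vs' , π , bs' = arms-prune bs σ in
      R , _ , next (down π) , subst (TreeValue k (node v (node c₁ us ∷ node c₂ vs' ∷ []))) (sym eq) (rec as bs')

  value-bistar-sym : ∀ k {v c₁ c₂ us vs ls ms} →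
                     BistarValue k v c₂ c₁ vs us ms ls → BistarValue k v c₁ c₂ us vs ls ms
  value-bistar-sym k {v} {c₁} {c₂} {us} {vs} {ls} {ms} val = swap-children v (node c₁ us) (node c₂ vs)
    (subst (TreeValue k (node v (node c₂ vs ∷ node c₁ us ∷ []))) (⊙-comm (class ms) (class ls)) val)

  value-bistar : ∀ k {v c₁ c₂ us vs ls ms} → Arms us ls → Arms vs ms → BistarValue k v c₁ c₂ us vs ls ms
  -- A bare centre counts as having an arm of length 0: `class (0 ∷ [])` computes to `class []`.
  value-bistar k [] bs = value-bistar-short k (link end) bs
  value-bistar k (a ∷ []) bs = value-bistar-short k (link (link a)) bs
  value-bistar k {ls = ls} as@(_ ∷ _ ∷ _) [] =
    value-bistar-sym k {ls = ls} {[]} (value-bistar-short k (link end) as)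
  value-bistar k {ls = ls} {ms} as@(_ ∷ _ ∷ _) (b ∷ []) =
    value-bistar-sym k {ls = ls} {ms} (value-bistar-short k (link (link b)) as)
  value-bistar zero (_ ∷ _ ∷ _) (_ ∷ _ ∷ _) = value-zero
  value-bistar (suc k) as@(_ ∷ _ ∷ _) bs@(_ ∷ _ ∷ _) =
    value-bistar-long (value-bistar k) as (s≤s (s≤s z≤n)) bs (s≤s (s≤s z≤n))

-- The graphs of stars and bistars

range : ℕ → ℕ → List ℕ
range p zero    = []
range p (suc m) = p ∷ range (suc p) m

range-++ : ∀ p m n → range p (m + n) ≡ range p m ++ range (p + m) n
range-++ p zero    n = cong (λ q → range q n) (sym (+-identityʳ p))
range-++ p (suc m) n = cong (p ∷_) (trans (range-++ (suc p) m n)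
  (cong (λ q → range (suc p) m ++ range q n) (sym (+-suc p m))))

range-bounds : ∀ p m → All (λ x → p ≤ x × x < p + m) (range p m)
range-bounds p zero    = []
range-bounds p (suc m) = (≤-refl , m<m+n p (s≤s z≤n)) ∷
  All.map (λ {x} (lo , hi) → ≤-trans (m≤n⇒m≤1+n ≤-refl) lo , subst (x <_) (sym (+-suc p m)) hi) (range-bounds (suc p) m)

range-unique : ∀ p m → Unique (range p m)
range-unique p zero    = []
range-unique p (suc m) = All.map (λ (lo , _) eq → <-irrefl eq lo) (range-bounds (suc p) m) ∷ range-unique (suc p) m

∈-range : ∀ p m {x} → p ≤ x → x < p + m → x ∈ range p m
∈-range p zero {x} lo hi = ⊥-elim (<-irrefl refl (≤-trans hi (subst (_≤ x) (sym (+-identityʳ p)) lo)))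
∈-range p (suc m) {x} lo hi with m≤n⇒m<n∨m≡n lo
... | inj₁ p<x  = there (∈-range (suc p) m p<x (subst (x <_) (+-suc p m) hi))
... | inj₂ refl = here refl

length-range : ∀ p m → length (range p m) ≡ m
length-range p zero    = refl
length-range p (suc m) = cong suc (length-range (suc p) m)

Ascending : List (ℕ × ℕ) → Set
Ascending = All λ (x , y) → x < y

targets-chain : ∀ p m → map proj₂ (chain p m) ≡ range (suc p) m
targets-chain p zero    = refl
targets-chain p (suc m) = cong (suc p ∷_) (targets-chain (suc p) m)

ascending-chain : ∀ p m → Ascending (chain p m)
ascending-chain p zero    = []
ascending-chain p (suc m) = n<1+n p ∷ ascending-chain (suc p) m

targets-path : ∀ o p l → map proj₂ (pathEdges o p l) ≡ range p l
targets-path o p zero    = refl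
targets-path o p (suc l) = cong (p ∷_) (targets-chain p l)

ascending-path : ∀ {o p} l → o < p → Ascending (pathEdges o p l)
ascending-path zero    o<p = []
ascending-path (suc l) o<p = o<p ∷ ascending-chain _ l

targets-++ : ∀ (es : List (ℕ × ℕ)) {fs p m n} → map proj₂ es ≡ range p m → map proj₂ fs ≡ range (p + m) n →
             map proj₂ (es ++ fs) ≡ range p (m + n)
targets-++ es {fs} {p} {m} {n} eq eq' = trans (map-++ proj₂ es fs) (trans (cong₂ _++_ eq eq') (sym (range-++ p m n)))

-- The edges list the non-central vertices as second components in numerical order. This gives both
-- uniqueness of parents and an enumeration of the vertices.
targets-star : ∀ o p ls → map proj₂ (starEdgesFrom o p ls) ≡ range p (sum ls)
targets-star o p []       = refl
targets-star o p (l ∷ ls) = targets-++ (pathEdges o p l) (targets-path o p l) (targets-star o (p + l) ls)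

ascending-star : ∀ {o p} ls → o < p → Ascending (starEdgesFrom o p ls)
ascending-star []       o<p = []
ascending-star (l ∷ ls) o<p = All.++⁺ (ascending-path l o<p) (ascending-star ls (<-≤-trans o<p (m≤m+n _ l)))

targets-attach : ∀ o S → map proj₂ (attach o S) ≡ range o (optSize S)
targets-attach o nothing  = refl
targets-attach o (just S) = cong (o ∷_) (targets-star o (suc o) (SubdividedStar.paths S))

ascending-attach : ∀ {o} S → 0 < o → Ascending (attach o S)
ascending-attach nothing  0<o = []
ascending-attach (just S) 0<o = 0<o ∷ ascending-star (SubdividedStar.paths S) (n<1+n _)

target-unique : ∀ {E : List (ℕ × ℕ)} → Unique (map proj₂ E) → ∀ {x x' y} → (x , y) ∈ E → (x' , y) ∈ E → x ≡ x'
target-unique u (here refl) (here refl) = refl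
target-unique u (here refl) (there e)   = ⊥-elim (unique-head u (∈-map⁺ proj₂ e) refl)
target-unique u (there e)   (here refl) = ⊥-elim (unique-head u (∈-map⁺ proj₂ e) refl)
target-unique (_ ∷ u) (there e) (there e') = target-unique u e e'

module _ {m : ℕ} where

  -- Reduction mod `suc m` makes this total, so trees are built without carrying bounds;
  -- `toℕ-vertex` restores the index where it is in range.
  vertex : ℕ → Fin (suc m)
  vertex x = x mod suc m

  vertex² : ℕ × ℕ → Fin (suc m) × Fin (suc m)
  vertex² (x , y) = vertex x , vertex y

  toℕ-vertex : ∀ {x} → x < suc m → toℕ (vertex x) ≡ x
  toℕ-vertex {x} x< = trans (toℕ-fromℕ< (m%n<n x (suc m))) (m<n⇒m%n≡m x<)

  vertex-toℕ : ∀ v → vertex (toℕ v) ≡ v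
  vertex-toℕ v = toℕ-injective (toℕ-vertex (toℕ<n v))

  chainTrees : ℕ → ℕ → List (Tree {Fin (suc m)})
  chainTrees p zero    = []
  chainTrees p (suc l) = node (vertex p) (chainTrees (suc p) l) ∷ []

  starTrees : ℕ → List ℕ → List (Tree {Fin (suc m)})
  starTrees p []           = []
  -- The offset is left as `p + 0` to agree literally with `starEdgesFrom`.
  starTrees p (zero ∷ ls)  = starTrees (p + 0) ls
  starTrees p (suc l ∷ ls) = node (vertex p) (chainTrees (suc p) l) ∷ starTrees (p + suc l) ls

  attachTrees : ℕ → OptStar → List (Tree {Fin (suc m)})
  attachTrees o nothing  = []
  attachTrees o (just S) = node (vertex o) (starTrees (suc o) (SubdividedStar.paths S)) ∷ []

  edges-chain : ∀ p l → edges (vertex p) (chainTrees (suc p) l) ≡ map vertex² (chain p l)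
  edges-chain p zero    = refl
  edges-chain p (suc l) = cong (_ ∷_) (trans (++-identityʳ _) (edges-chain (suc p) l))

  edges-star : ∀ o p ls → edges (vertex o) (starTrees p ls) ≡ map vertex² (starEdgesFrom o p ls)
  edges-star o p []           = refl
  edges-star o p (zero ∷ ls)  = edges-star o (p + 0) ls
  edges-star o p (suc l ∷ ls) = cong (_ ∷_) (trans (cong₂ _++_ (edges-chain p l) (edges-star o (p + suc l) ls))
                                                  (sym (map-++ vertex² (chain p l) _)))

  edges-attach : ∀ o S → edges (vertex 0) (attachTrees o S) ≡ map vertex² (attach o S)
  edges-attach o nothing  = refl
  edges-attach o (just S) = cong (_ ∷_) (trans (++-identityʳ _) (edges-star o (suc o) (SubdividedStar.paths S)))

  chain-shape : ∀ p l → Chain (node (vertex p) (chainTrees (suc p) l)) (suc l)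
  chain-shape p zero    = end
  chain-shape p (suc l) = link (chain-shape (suc p) l)

  star-shape : ∀ p {ls} → All (1 ≤_) ls → Arms (starTrees p ls) ls
  star-shape p []                         = []
  star-shape p {suc l ∷ ls} (s≤s _ ∷ pos) = chain-shape p l ∷ star-shape (p + suc l) pos

edges-++ : ∀ {V : Set} (p : V) ts us → edges p (ts ++ us) ≡ edges p ts ++ edges p us
edges-++ p []               us = refl
edges-++ p (node x vs ∷ ts) us =
  cong (_ ∷_) (trans (cong (edges x vs ++_) (edges-++ p ts us)) (sym (++-assoc (edges x vs) _ _)))

module Initial (m : ℕ) (E : List (ℕ × ℕ)) (targets : map proj₂ E ≡ range 1 m) (ascending : Ascending E) where

  graph : Graph
  graph = record { n = suc m ; E = E }

  isForest : IsForest graph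
  isForest = record
    { up     = λ e → All.lookup ascending e
    ; parent = target-unique (subst Unique (sym targets) (range-unique 1 m))
    }

  open Positions graph isForest

  target< : ∀ {x y} → (x , y) ∈ E → y < suc m
  target< e = proj₂ (All.lookup (range-bounds 1 m) (subst (_ ∈_) targets (∈-map⁺ proj₂ e)))

  shows : ∀ {ts} → edges (vertex 0) ts ≡ map vertex² E →
          Shows (suc m) (λ _ → ⊤) (vertex 0 ∷ labels ts) (edges (vertex 0) ts)
  shows {ts} eq = record
    { size   = ≤-reflexive (trans (cong length L≡)
                 (trans (length-map vertex (range 0 (suc m))) (length-range 0 (suc m))))
    ; unique = unique-map⁻ {f = toℕ} (subst Unique (sym toℕL≡) (range-unique 0 (suc m)))
    ; to     = λ {v} _ → subst (v ∈_) (sym L≡) (subst (_∈ map vertex (range 0 (suc m))) (vertex-toℕ v)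
                  (∈-map⁺ vertex (∈-range 0 (suc m) z≤n (toℕ<n v))))
    ; from   = λ _ → tt
    ; inside = λ e → source∈ ts e , there (target∈ e)
    ; linked = λ {u} {v} _ _ → λ { (inj₁ e) → inj₁ (edge u v e) ; (inj₂ e) → inj₂ (edge v u e) }
    ; joined = λ e → inj₁ (edge⁻ (subst (_ ∈_) eq e))
    }
    where
    L≡ : vertex 0 ∷ labels ts ≡ map vertex (range 0 (suc m))
    L≡ = cong (vertex 0 ∷_) (trans (sym (labels≡targets (vertex 0) ts)) (trans (cong (map proj₂) eq)
           (trans (sym (map-∘ E)) (trans (map-∘ E) (cong (map vertex) targets)))))
    toℕL≡ : map toℕ (vertex 0 ∷ labels ts) ≡ range 0 (suc m)
    toℕL≡ = trans (cong (map toℕ) L≡) (trans (sym (map-∘ (range 0 (suc m))))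
              (map-id-local (All.map (λ (_ , hi) → toℕ-vertex hi) (range-bounds 0 (suc m)))))
    edge : ∀ u v → (toℕ u , toℕ v) ∈ E → (u , v) ∈ edges (vertex 0) ts
    edge u v e = subst₂ (λ x y → (x , y) ∈ edges (vertex 0) ts) (vertex-toℕ u) (vertex-toℕ v)
                   (subst (vertex² (toℕ u , toℕ v) ∈_) (sym eq) (∈-map⁺ vertex² e))
    edge⁻ : ∀ {u v} → (u , v) ∈ map vertex² E → (toℕ u , toℕ v) ∈ E
    edge⁻ e with ∈-map⁻ vertex² e
    ... | (x , y) , e' , refl = subst₂ (λ x y → (x , y) ∈ E)
      (sym (toℕ-vertex (<-trans (All.lookup ascending e') (target< e')))) (sym (toℕ-vertex (target< e'))) e'

open SubdividedStar using (paths; positive)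

-- An empty side leaves `v` as an arm of length 1 at the other centre, while `S₂` makes an arm of
-- length 4: the residues agree, so the empty graph shares the class of `S₂`.
optClass : OptStar → Cls
optClass nothing  = D0*
optClass (just S) = class (paths S)

grundy-star : ∀ S → Grundy (graphOf (just S)) (value (class (paths S)))
grundy-star S = value-star graph isForest _ (star-shape 1 (positive S)) (shows (edges-star 0 1 (paths S)))
  where open Initial (sum (paths S)) (starEdges 0 S) (targets-star 0 1 (paths S)) (ascending-star (paths S) (n<1+n 0))

opaque
  unfolding _⊙_

  D0*⊙D0* : D0* ⊙ D0* ≡ 1
  D0*⊙D0* = refl

grundy-bistar : ∀ S S' → Grundy (bistar S S') (optClass S ⊙ optClass S')
grundy-bistar S S' = val S S' (shows (trans (edges-++ (vertex 0) (attachTrees 1 S) _)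
    (trans (cong₂ _++_ (edges-attach 1 S) (edges-attach o S')) (sym (map-++ vertex² (attach 1 S) (attach o S'))))))
  where
  o = suc (optSize S)
  open Initial (optSize S + optSize S') (attach 1 S ++ attach o S')
    (targets-++ (attach 1 S) (targets-attach 1 S) (targets-attach o S'))
    (All.++⁺ (ascending-attach S (s≤s z≤n)) (ascending-attach S' (s≤s z≤n)))
  open Positions graph isForest
  one-sided : ∀ {k v x us ls} → Arms us ls → TreeValue k (node v (node x us ∷ [])) (D0* ⊙ class ls)
  one-sided {k} {v} {x} {us} {ls} as = reroot v x us []
    (subst (TreeValue k (node x (node v [] ∷ us))) (proj₂ (proj₂ (hanging (proj₁ (count ls)) (proj₂ (count ls)))))
      (value-star graph isForest k (end ∷ as)))
  val : ∀ S S' {o o' k} →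
        TreeValue k (node (vertex 0) (attachTrees o S ++ attachTrees o' S')) (optClass S ⊙ optClass S')
  val nothing nothing {k = k} = subst (TreeValue k (node (vertex 0) [])) (sym D0*⊙D0*) (value-path k end)
  val nothing (just S') = one-sided (star-shape _ (positive S'))
  val (just S) nothing {o} {k = k} =
    subst (TreeValue k (node (vertex 0) (attachTrees o (just S)))) (⊙-comm D0* (class (paths S)))
      (one-sided (star-shape _ (positive S)))
  val (just S) (just S') = value-bistar graph isForest _ (star-shape _ (positive S)) (star-shape _ (positive S'))

-- The classes of `ℛ`, their disjointness, and the equivalence `∼₂`

classOf : ℛ → Cls
classOf empty      = D0*
classOf (star a b) = cls a b

count-replicate : ∀ a b → count (replicate a 1 ++ replicate b 2) ≡ (a , b)
count-replicate (suc a) b    = cong (add (suc zero)) (count-replicate a b)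
count-replicate zero (suc b) = cong (add (suc (suc zero))) (count-replicate zero b)
count-replicate zero zero    = refl

shortArms : ℕ → ℕ → SubdividedStar
shortArms a b = record { paths = replicate a 1 ++ replicate b 2 ; positive = all12 a b }

optClass-toStar : ∀ S → optClass (toStar S) ≡ classOf S
optClass-toStar empty      = refl
optClass-toStar (star a b) = cong cls′ (count-replicate a b)

grundy-ℛ : ∀ S → 𝒢ℛ S (value (classOf S))
grundy-ℛ empty        = refl
grundy-ℛ S@(star a b) = subst (λ C → 𝒢ℛ S (value C)) (optClass-toStar S) (grundy-star (shortArms a b))

𝒢ℛ-unique : ∀ S {g h} → 𝒢ℛ S g → 𝒢ℛ S h → g ≡ h
𝒢ℛ-unique S = grundy-unique {graphOf (toStar S)} (Graph.n (graphOf (toStar S)))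

grundy-ℛ-bistar : ∀ S Ŝ → Grundy (bistar (toStar S) Ŝ) (classOf S ⊙ optClass Ŝ)
grundy-ℛ-bistar S Ŝ =
  subst (λ C → Grundy (bistar (toStar S) Ŝ) (C ⊙ optClass Ŝ)) (optClass-toStar S) (grundy-bistar (toStar S) Ŝ)

data Plain : Cls → Set where
  p0 : Plain D0
  p1 : Plain D1
  p2 : Plain D2
  p3 : Plain D3

-- Every special class bounds the number of arms of length 2 by three, so from four on only the `Dᵢ`
-- remain; the recursion follows the two periods.
tall-plain : ∀ a b → Plain (cls a (4 + b))
tall-plain 0 0 = p0
tall-plain 1 0 = p1
tall-plain 2 0 = p0
tall-plain 3 0 = p1
tall-plain 0 1 = p2
tall-plain 1 1 = p3
tall-plain 2 1 = p2
tall-plain 3 1 = p3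
tall-plain (suc (suc (suc (suc a)))) b = tall-plain (suc (suc a)) b
tall-plain 0 (suc (suc b)) = tall-plain 0 b
tall-plain 1 (suc (suc b)) = tall-plain 1 b
tall-plain 2 (suc (suc b)) = tall-plain 2 b
tall-plain 3 (suc (suc b)) = tall-plain 3 b

plain-in : ∀ {C S} → Plain C → 𝒢ℛ S (value C) → ¬ Special S → InClass C S
plain-in p0 g ¬s = g , ¬s
plain-in p1 g ¬s = g , ¬s
plain-in p2 g ¬s = g , ¬s
plain-in p3 g ¬s = g , ¬s

tall-not-special : ∀ {a b} → ¬ Special (star a (4 + b))
tall-not-special (inj₁ (inj₁ (_ , inj₁ ())))
tall-not-special (inj₁ (inj₁ (_ , inj₂ ())))
tall-not-special (inj₁ (inj₂ ()))
tall-not-special (inj₂ (inj₁ (inj₁ ())))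
tall-not-special (inj₂ (inj₁ (inj₂ (inj₁ ()))))
tall-not-special (inj₂ (inj₁ (inj₂ (inj₂ ()))))
tall-not-special (inj₂ (inj₂ (inj₁ (_ , _ , _ , inj₁ ()))))
tall-not-special (inj₂ (inj₂ (inj₁ (_ , _ , _ , inj₂ ()))))
tall-not-special (inj₂ (inj₂ (inj₂ (inj₁ (inj₁ ())))))
tall-not-special (inj₂ (inj₂ (inj₂ (inj₁ (inj₂ ())))))
tall-not-special (inj₂ (inj₂ (inj₂ (inj₂ (inj₁ (_ , _ , inj₁ ()))))))
tall-not-special (inj₂ (inj₂ (inj₂ (inj₂ (inj₁ (_ , _ , inj₂ ()))))))
tall-not-special (inj₂ (inj₂ (inj₂ (inj₂ (inj₂ (_ , _ , inj₁ ()))))))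
tall-not-special (inj₂ (inj₂ (inj₂ (inj₂ (inj₂ (_ , _ , inj₂ ()))))))

-- Past the small exceptions, the stars with 0 or 2 arms of length 2 alternate between values 0 and
-- 1, those with 1 or 3 between values 2 and 3.
data EvenRow : Cls → Set where
  e0 : EvenRow D0*
  e1 : EvenRow D1□

data OddRow : Cls → Set where
  o2 : OddRow D2□
  o3 : OddRow D3□

row₀ : ∀ a → EvenRow (cls (2 + a) 0)
row₀ 0 = e0
row₀ 1 = e1
row₀ (suc (suc a)) = row₀ a

row₁ : ∀ a → OddRow (cls (2 + a) 1)
row₁ 0 = o2
row₁ 1 = o3
row₁ (suc (suc a)) = row₁ a

row₂ : ∀ a → EvenRow (cls (1 + a) 2)
row₂ 0 = e0
row₂ 1 = e1
row₂ 2 = e0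
row₂ (suc (suc (suc a))) = row₂ (suc a)

row₃ : ∀ a → OddRow (cls (1 + a) 3)
row₃ 0 = o2
row₃ 1 = o3
row₃ 2 = o2
row₃ (suc (suc (suc a))) = row₃ (suc a)

even-in : ∀ {C a b} → EvenRow C → 𝒢ℛ (star a b) (value C) → ZeroOrTwo b → star a b ≢ P₁ → InClass C (star a b)
even-in e0 g z _ = inj₁ (g , z)
even-in e1 g z ≢P₁ = tt , ≢P₁ , g , z

odd-in : ∀ {C a b} → OddRow C → 𝒢ℛ (star a b) (value C) → OneOrThree b → InClass C (star a b)
odd-in o2 g o = tt , g , o
odd-in o3 g o = tt , g , o

inClass : ∀ S → InClass (classOf S) S
inClass empty = inj₁ (refl , inj₁ refl)
inClass (star 0 0) = inj₁ refl
inClass (star 1 0) = inj₁ refl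
inClass S@(star (suc (suc a)) 0) = even-in (row₀ a) (grundy-ℛ S) (inj₁ refl) λ ()
inClass (star 0 1) = inj₂ refl
inClass (star 1 1) = inj₂ (inj₁ refl)
inClass S@(star (suc (suc a)) 1) = odd-in (row₁ a) (grundy-ℛ S) (inj₁ refl)
inClass (star 0 2) = inj₂ refl
inClass S@(star (suc a) 2) = even-in (row₂ a) (grundy-ℛ S) (inj₂ refl) λ ()
inClass (star 0 3) = inj₂ (inj₂ refl)
inClass S@(star (suc a) 3) = odd-in (row₃ a) (grundy-ℛ S) (inj₂ refl)
inClass S@(star a (suc (suc (suc (suc b))))) = plain-in (tall-plain a b) (grundy-ℛ S) tall-not-special

inClass-value : ∀ C S → InClass C S → 𝒢ℛ S (value C)
inClass-value D0 S (g , _) = g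
inClass-value D0* S (inj₁ (g , _)) = g
inClass-value D0* S (inj₂ refl) = grundy-ℛ S₂
inClass-value D1 S (g , _) = g
inClass-value D1* S (inj₁ refl) = grundy-ℛ P₁
inClass-value D1* S (inj₂ (inj₁ refl)) = grundy-ℛ S₂₁
inClass-value D1* S (inj₂ (inj₂ refl)) = grundy-ℛ S₂₂₂
inClass-value D1□ S (_ , _ , g , _) = g
inClass-value D2 S (g , _) = g
inClass-value D2* S (inj₁ refl) = grundy-ℛ S₁
inClass-value D2* S (inj₂ refl) = grundy-ℛ S₂₂
inClass-value D2□ S (_ , g , _) = g
inClass-value D3 S (g , _) = g
inClass-value D3□ S (_ , g , _) = g

D1*-D1□ : ∀ {S} → D₁* S → ¬ D₁□ S
D1*-D1□ (inj₁ refl) (_ , ≢P₁ , _) = ≢P₁ refl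
D1*-D1□ (inj₂ (inj₁ refl)) (_ , _ , _ , inj₁ ())
D1*-D1□ (inj₂ (inj₁ refl)) (_ , _ , _ , inj₂ ())
D1*-D1□ (inj₂ (inj₂ refl)) (_ , _ , _ , inj₁ ())
D1*-D1□ (inj₂ (inj₂ refl)) (_ , _ , _ , inj₂ ())

D2*-D2□ : ∀ {S} → D₂* S → ¬ D₂□ S
D2*-D2□ (inj₁ refl) (_ , _ , inj₁ ())
D2*-D2□ (inj₁ refl) (_ , _ , inj₂ ())
D2*-D2□ (inj₂ refl) (_ , _ , inj₁ ())
D2*-D2□ (inj₂ refl) (_ , _ , inj₂ ())

-- Different values make the equation absurd. Within one value, each `Dᵢ` excludes the special
-- classes by definition, and starred and boxed ones differ in shape.
same-value : ∀ {S} C C' → value C ≡ value C' → InClass C S → InClass C' S → C ≡ C'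
same-value D0  D0  _ _ _ = refl
same-value D0  D0* _ (_ , ¬s) s = ⊥-elim (¬s (inj₁ s))
same-value D0* D0  _ s (_ , ¬s) = ⊥-elim (¬s (inj₁ s))
same-value D0* D0* _ _ _ = refl
same-value D1  D1  _ _ _ = refl
same-value D1  D1* _ (_ , ¬s) s = ⊥-elim (¬s (inj₂ (inj₁ s)))
same-value D1  D1□ _ (_ , ¬s) s = ⊥-elim (¬s (inj₂ (inj₂ (inj₁ s))))
same-value D1* D1  _ s (_ , ¬s) = ⊥-elim (¬s (inj₂ (inj₁ s)))
same-value D1* D1* _ _ _ = refl
same-value D1* D1□ _ s s' = ⊥-elim (D1*-D1□ s s')
same-value D1□ D1  _ s (_ , ¬s) = ⊥-elim (¬s (inj₂ (inj₂ (inj₁ s))))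
same-value D1□ D1* _ s s' = ⊥-elim (D1*-D1□ s' s)
same-value D1□ D1□ _ _ _ = refl
same-value D2  D2  _ _ _ = refl
same-value D2  D2* _ (_ , ¬s) s = ⊥-elim (¬s (inj₂ (inj₂ (inj₂ (inj₁ s)))))
same-value D2  D2□ _ (_ , ¬s) s = ⊥-elim (¬s (inj₂ (inj₂ (inj₂ (inj₂ (inj₁ s))))))
same-value D2* D2  _ s (_ , ¬s) = ⊥-elim (¬s (inj₂ (inj₂ (inj₂ (inj₁ s)))))
same-value D2* D2* _ _ _ = refl
same-value D2* D2□ _ s s' = ⊥-elim (D2*-D2□ s s')
same-value D2□ D2  _ s (_ , ¬s) = ⊥-elim (¬s (inj₂ (inj₂ (inj₂ (inj₂ (inj₁ s))))))
same-value D2□ D2* _ s s' = ⊥-elim (D2*-D2□ s' s)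
same-value D2□ D2□ _ _ _ = refl
same-value D3  D3  _ _ _ = refl
same-value D3  D3□ _ (_ , ¬s) s = ⊥-elim (¬s (inj₂ (inj₂ (inj₂ (inj₂ (inj₂ s))))))
same-value D3□ D3  _ s (_ , ¬s) = ⊥-elim (¬s (inj₂ (inj₂ (inj₂ (inj₂ (inj₂ s))))))
same-value D3□ D3□ _ _ _ = refl

disjoint : ∀ S C C' → InClass C S → InClass C' S → C ≡ C'
disjoint S C C' i i' = same-value C C' (𝒢ℛ-unique S (inClass-value C S i) (inClass-value C' S i')) i i'

witness : ∀ C → ∃ λ S → classOf S ≡ C
witness D0  = star 0 4 , refl
witness D0* = star 0 1 , refl
witness D1  = star 1 4 , refl
witness D1* = star 0 0 , refl
witness D1□ = star 3 0 , refl
witness D2  = star 0 5 , refl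
witness D2* = star 1 0 , refl
witness D2□ = star 2 1 , refl
witness D3  = star 1 5 , refl
witness D3□ = star 3 1 , refl

row : Cls → List ℕ
row C = map (C ⊙_) classes

-- Recovers a class from its row, so that distinctness takes ten evaluations rather than one
-- comparison per pair.
withRow : List ℕ → List Cls
withRow r = filter (λ C → ≡-dec _≟ℕ_ (row C) r) classes

opaque
  unfolding _⊙_

  withRow-row : ∀ C → withRow (row C) ≡ C ∷ []
  withRow-row D0  = refl
  withRow-row D0* = refl
  withRow-row D1  = refl
  withRow-row D1* = refl
  withRow-row D1□ = refl
  withRow-row D2  = refl
  withRow-row D2* = refl
  withRow-row D2□ = refl
  withRow-row D3  = refl
  withRow-row D3□ = refl

rows-distinct : ∀ C C' → (∀ D → C ⊙ D ≡ C' ⊙ D) → C ≡ C'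
rows-distinct C C' eq = ∷-injectiveˡ
  (trans (sym (withRow-row C)) (trans (cong withRow (map-cong eq classes)) (withRow-row C')))

∼₂⇔class : ∀ S S' → (toStar S ∼₂ toStar S') ⇔ (classOf S ≡ classOf S')
∼₂⇔class S S' = mk⇔
  -- Each class is that of some star in `ℛ`, so testing against ten stars yields the entire row.
  (λ equiv → rows-distinct (classOf S) (classOf S') λ D → same-column D (witness D) equiv)
  λ eq Ŝ → classOf S ⊙ optClass Ŝ , grundy-ℛ-bistar S Ŝ ,
    subst (λ C → Grundy (bistar (toStar S') Ŝ) (C ⊙ optClass Ŝ)) (sym eq) (grundy-ℛ-bistar S' Ŝ)
  where
  same-column : ∀ D → (∃ λ T → classOf T ≡ D) → toStar S ∼₂ toStar S' → classOf S ⊙ D ≡ classOf S' ⊙ D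
  same-column D (T , refl) equiv =
    let g , γ , γ' = equiv (toStar T) in
    subst (λ D → classOf S ⊙ D ≡ classOf S' ⊙ D) (optClass-toStar T)
      (trans (sym (grundy-unique {bistar (toStar S) (toStar T)} _ γ (grundy-ℛ-bistar S (toStar T))))
             (grundy-unique {bistar (toStar S') (toStar T)} _ γ' (grundy-ℛ-bistar S' (toStar T))))

grundy-table : ∀ S S' C C' g g' → InClass C S → InClass C' S' → 𝒢ℛ S g → 𝒢ℛ S' g' →
               Grundy (bistar (toStar S) (toStar S')) (evalEntry (table C C') g g')
grundy-table S S' C C' g g' i i' γ γ'
  with refl ← disjoint S C (classOf S) i (inClass S)
  with refl ← disjoint S' C' (classOf S') i' (inClass S')
  with refl ← 𝒢ℛ-unique S γ (grundy-ℛ S)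
  with refl ← 𝒢ℛ-unique S' γ' (grundy-ℛ S') =
  subst (Grundy (bistar (toStar S) (toStar S')))
    (trans (cong (classOf S ⊙_) (optClass-toStar S')) (sym (⊙-def (classOf S) (classOf S'))))
    (grundy-ℛ-bistar S (toStar S'))

theorem6 : (∀ (S : ℛ) → ∃ λ (C : Cls) → InClass C S)
    × (∀ (S : ℛ) (C C' : Cls) → InClass C S → InClass C' S → C ≡ C')
    × (∀ (C : Cls) → ∃ λ (S : ℛ) → InClass C S)
    × (∀ (S S' : ℛ) (C C' : Cls) → InClass C S → InClass C' S'
    → ((toStar S ∼₂ toStar S') ⇔ (C ≡ C')))
    × (∀ (S S' : ℛ) (C C' : Cls) (g g' : ℕ) → InClass C S → InClass C' S'
    → 𝒢ℛ S g → 𝒢ℛ S' g'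
    → Grundy (bistar (toStar S) (toStar S')) (evalEntry (table C C') g g'))
theorem6 =
  (λ S → classOf S , inClass S) ,
  disjoint ,
  (λ C → let S , eq = witness C in S , subst (λ C → InClass C S) eq (inClass S)) ,
  (λ S S' C C' i i' → subst₂ (λ C C' → (toStar S ∼₂ toStar S') ⇔ (C ≡ C'))
    (disjoint S (classOf S) C (inClass S) i) (disjoint S' (classOf S') C' (inClass S') i') (∼₂⇔class S S')) ,
  grundy-table
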